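{- Let $X$ be a set of $n$ points with similarity function $S$, suppose the target clustering $\mathcal{C}^{\ast}=\{C^{\ast}_1,\dots,C^{\ast}_k\}$ satisfies strict separation with respect to $S$, and suppose the initial clustering has overclustering error $\delta_o$ and underclustering error $\delta_u$. In the $\eta$-merge model, for any $\eta>0.5$, the interactive algorithm using the local split procedure and the local merge procedure (described below) requires at most $\delta_o$ split requests and $2(\delta_u+k)\log_{\frac{1}{1-\eta}} n$ merge requests to find the target clustering.
   Context: $\mathcal{C}^{\ast}$ satisfies strict separation w.r.t. $S$ if for all $i\neq j$, all $x,y\in C^{\ast}_i$ and $z\in C^{\ast}_j$: $S(x,y)>S(x,z)$. For clusterings $\mathcal{C},\mathcal{C}'$, $\mathrm{dist}(\mathcal{C},\mathcal{C}')=\sum_{A\in\mathcal{C}}(|\{B\in\mathcal{C}':B\cap A\neq\emptyset\}|-1)$; for the initial clustering $\mathcal{C}$, $\delta_u=\mathrm{dist}(\mathcal{C}^{\ast},\mathcal{C})$, $\delta_o=\mathrm{dist}(\mathcal{C},\mathcal{C}^{\ast})$. For a finite $Y\subseteq X$, the average-linkage tree of $Y$ is built by starting with singletons of $Y$ as leaves and repeatedly merging the two current nodes $N_1,N_2$ with largest average similarity $S(N_1,N_2)=\mathrm{avg}_{x\in N_1,y\in N_2}S(x,y)$ (ties arbitrary) into parent $N_1\cup N_2$ until a root $Y$ remains. Process ($\eta$-merge model): start from the initial clustering, all clusters labelled "impure". An oracle repeatedly issues split$(C_i)$ (only if current cluster $C_i$ has points of two or more target clusters) or merge$(C_i,C_j)$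 for distinct current clusters (only if some target cluster $C^{\ast}_l$ has $|C_i\cap C^{\ast}_l|\ge\eta|C_i|$ and $|C_j\cap C^{\ast}_l|\ge\eta|C_j|$). Local split procedure: let $T_{loc}$ be the average-linkage tree of $C_i$; replace $C_i$ by the two children of the root of $T_{loc}$, both labelled "impure". Local merge procedure: let $T_{loc}$ be the average-linkage tree of $C_i\cup C_j$; $\eta_1=1$ if $C_i$ is labelled "pure", else $\eta_1=\eta$; $\eta_2$ likewise for $C_j$; find a node $N$ of $T_{loc}$ of maximal depth with $|N\cap C_i|\ge\eta_1|C_i|$ and $|N\cap C_j|\ge\eta_2|C_j|$; replace $C_i$ by $C_i\setminus N$, $C_j$ by $C_j\setminus N$ (labels kept, empty clusters discarded) and add the new cluster $N\cap(C_i\cup C_j)$ labelled "pure". The bounds hold for any sequence of allowed requests, counting requests until the current clustering equals $\mathcal{C}^{\ast}$.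
   Formalization: η<1 and a symmetric S are assumed; as the merge bound fails for η near 1 (n=2, two singletons, one target, η>15/16), it is proved with the logarithm rounded up for all η in (1/2,1), and unrounded when 1/(1-η) ≤ n². -}

module Defs where

open import Algebra.Bundles using (CommutativeRing; Semiring)
import Algebra.Definitions.RawSemiring as RawSemiringDefs
open import Data.Fin using (Fin)
open import Data.Fin.Subset using (Subset; _∈_; _∩_; _∪_; _─_; ⁅_⁆; ∣_∣; Nonempty; Empty)
open import Data.Fin.Subset.Properties using (_∈?_; nonempty?)
open import Data.List using (List; []; _∷_; _++_; map; filter; foldr; length; allFin)
open import Data.List.Membership.Propositional using () renaming (_∈_ to _∈ˡ_)
open import Data.List.Relation.Binary.BagAndSetEquality using (_∼[_]_; set)
open import Data.List.Relation.Binary.Permutation.Propositional using (_↭_)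
open import Data.List.Relation.Unary.All using (All)
open import Data.List.Relation.Unary.AllPairs using (AllPairs)
open import Data.List.Relation.Unary.Any using (Any)
open import Data.Nat as ℕ using (ℕ; suc; _∸_)
open import Data.Nat.ListAction using (sum)
open import Data.Product using (_×_; _,_; proj₁)
open import Level using (_⊔_) renaming (suc to lsuc)
import Relation.Binary.Construct.StrictToNonStrict as ToNonStrict
open import Relation.Binary.Core using (Rel)
open import Relation.Binary.PropositionalEquality using (_≢_)
open import Relation.Binary.Structures using (IsStrictTotalOrder)
open import Relation.Nullary using (¬_)

-- Ordered fields play the role of ℝ, for similarities and for η.

record OrderedField c ℓ₁ ℓ₂ : Set (lsuc (c ⊔ ℓ₁ ⊔ ℓ₂)) where
  field
    commutativeRing : CommutativeRing c ℓ₁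

  open CommutativeRing commutativeRing public

  infix 4 _<_
  infix 8 _⁻¹

  field
    _<_                : Rel Carrier ℓ₂
    isStrictTotalOrder : IsStrictTotalOrder _≈_ _<_
    0<1                : 0# < 1#
    +-monoʳ-<          : ∀ x {y z} → y < z → x + y < x + z
    *-pos              : ∀ {x y} → 0# < x → 0# < y → 0# < x * y
    -- Total; the value at 0# is unconstrained.
    _⁻¹                : Carrier → Carrier
    ⁻¹-cong            : ∀ {x y} → x ≈ y → x ⁻¹ ≈ y ⁻¹
    *-inverseʳ         : ∀ {x} → ¬ (x ≈ 0#) → x * x ⁻¹ ≈ 1#

  open ToNonStrict _≈_ _<_ public using (_≤_)
  open RawSemiringDefs (Semiring.rawSemiring semiring) public using (_^_) renaming (_×_ to _×#_)

  fromℕ : ℕ → Carrier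
  fromℕ m = m ×# 1#

  -- For 1 < b and 0 < x: m ≤ K · log_b x, exponentiated to b ^ m ≤ x ^ K.
  LogBound : (m K : ℕ) (b x : Carrier) → Set (ℓ₁ ⊔ ℓ₂)
  LogBound m K b x = b ^ m ≤ x ^ K

  -- For 1 < b and 1 ≤ x: t = ⌈log_b x⌉.
  IsCeilLog : (b x : Carrier) (t : ℕ) → Set (ℓ₁ ⊔ ℓ₂)
  IsCeilLog b x t = x ≤ b ^ t × (∀ t′ → x ≤ b ^ t′ → t ℕ.≤ t′)

record Clustering (n : ℕ) : Set where
  field
    clusters : List (Subset n)
    nonempty : All Nonempty clusters
    disjoint : AllPairs (λ A B → Empty (A ∩ B)) clusters
    covers   : ∀ x → Any (x ∈_) clusters

  size : ℕ
  size = length clusters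

open Clustering public using (clusters; size)

hits : ∀ {n} → Clustering n → Subset n → ℕ
hits 𝒞 A = length (filter (λ B → nonempty? (B ∩ A)) (clusters 𝒞))

-- The truncated subtraction is exact: a nonempty A meets some cluster of 𝒞′.
dist : ∀ {n} → Clustering n → Clustering n → ℕ
dist 𝒞 𝒞′ = sum (map (λ A → hits 𝒞′ A ∸ 1) (clusters 𝒞))

elements : ∀ {n} → Subset n → List (Fin n)
elements A = filter (_∈? A) (allFin _)

data Tree (n : ℕ) : Set where
  leaf : Fin n → Tree n
  node : Tree n → Tree n → Tree n

points : ∀ {n} → Tree n → Subset n
points (leaf x)     = ⁅ x ⁆
points (node t₁ t₂) = points t₁ ∪ points t₂

-- NodeAt T d N: the set N is a node of T at depth d (the root has depth 0).
data NodeAt {n} : Tree n → ℕ → Subset n → Set where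
  here  : ∀ {t} → NodeAt t 0 (points t)
  left  : ∀ {t₁ t₂ d N} → NodeAt t₁ d N → NodeAt (node t₁ t₂) (suc d) N
  right : ∀ {t₁ t₂ d N} → NodeAt t₂ d N → NodeAt (node t₁ t₂) (suc d) N

data Label : Set where
  pure impure : Label

-- A current clustering; the order of the list is irrelevant.
State : ℕ → Set
State n = List (Subset n × Label)

keepNonempty : ∀ {n} → State n → State n
keepNonempty = filter (λ c → nonempty? (proj₁ c))

module Similarity {c ℓ₁ ℓ₂} (F : OrderedField c ℓ₁ ℓ₂) {n : ℕ}
                  (S : Fin n → Fin n → OrderedField.Carrier F) where
  open OrderedField F

  SymmetricSimilarity : Set ℓ₁
  SymmetricSimilarity = ∀ x y → S x y ≈ S y x

  StrictSeparation : Clustering n → Set ℓ₂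
  StrictSeparation 𝒞 = ∀ {A B} → A ∈ˡ clusters 𝒞 → B ∈ˡ clusters 𝒞 → A ≢ B →
                       ∀ {x y z} → x ∈ A → y ∈ A → z ∈ B → S x z < S x y

  Σ∈ : Subset n → (Fin n → Carrier) → Carrier
  Σ∈ A f = foldr (λ x s → f x + s) 0# (elements A)

  avg : Subset n → Subset n → Carrier
  avg A B = Σ∈ A (λ x → Σ∈ B (S x)) * (fromℕ (∣ A ∣ ℕ.* ∣ B ∣)) ⁻¹

  -- Linkage ts T: merging the trees ts, always choosing some pair of maximal
  -- average similarity, can end with the single tree T.
  data Linkage : List (Tree n) → Tree n → Set (ℓ₁ ⊔ ℓ₂) where
    done : ∀ {t} → Linkage (t ∷ []) t
    join : ∀ {ts t₁ t₂ rest T} → ts ↭ t₁ ∷ t₂ ∷ rest →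
           (∀ {u₁ u₂ rest′} → ts ↭ u₁ ∷ u₂ ∷ rest′ →
              avg (points u₁) (points u₂) ≤ avg (points t₁) (points t₂)) →
           Linkage (node t₁ t₂ ∷ rest) T → Linkage ts T

  AverageLinkage : Subset n → Tree n → Set (ℓ₁ ⊔ ℓ₂)
  AverageLinkage Y T = Linkage (map leaf (elements Y)) T

module Interaction {c ℓ₁ ℓ₂} (F : OrderedField c ℓ₁ ℓ₂) {n : ℕ}
                   (S : Fin n → Fin n → OrderedField.Carrier F)
                   (η : OrderedField.Carrier F)
                   (𝒞* 𝒞₀ : Clustering n) where
  open OrderedField F
  open Similarity F S

  -- A proportion of at least θ of the points of C lies in B.
  _Fraction_In_ : Carrier → Subset n → Subset n → Set (ℓ₁ ⊔ ℓ₂)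
  θ Fraction C In B = θ * fromℕ ∣ C ∣ ≤ fromℕ ∣ B ∩ C ∣

  initial : State n
  initial = map (_, impure) (clusters 𝒞₀)

  Found : State n → Set
  Found cs = map proj₁ cs ∼[ set ] clusters 𝒞*

  data Request (cs : State n) : Set (ℓ₁ ⊔ ℓ₂) where
    split : ∀ {C l rest} → cs ↭ (C , l) ∷ rest →
            2 ℕ.≤ hits 𝒞* C → Request cs
    merge : ∀ {C₁ l₁ C₂ l₂ rest} → cs ↭ (C₁ , l₁) ∷ (C₂ , l₂) ∷ rest →
            Any (λ B → η Fraction C₁ In B × η Fraction C₂ In B) (clusters 𝒞*) →
            Request cs

  threshold : Label → Carrier
  threshold pure   = 1#
  threshold impure = η

  Captures : (N : Subset n) (c₁ c₂ : Subset n × Label) → Set (ℓ₁ ⊔ ℓ₂)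
  Captures N (C₁ , l₁) (C₂ , l₂) =
    threshold l₁ Fraction C₁ In N × threshold l₂ Fraction C₂ In N

  data Outcome {cs : State n} : Request cs → State n → Set (ℓ₁ ⊔ ℓ₂) where
    split : ∀ {C l rest} {at : cs ↭ (C , l) ∷ rest} {ok} {t₁ t₂} →
            AverageLinkage C (node t₁ t₂) →
            Outcome (split at ok) ((points t₁ , impure) ∷ (points t₂ , impure) ∷ rest)
    merge : ∀ {C₁ l₁ C₂ l₂ rest} {at : cs ↭ (C₁ , l₁) ∷ (C₂ , l₂) ∷ rest} {ok} {T d N} →
            AverageLinkage (C₁ ∪ C₂) T →
            NodeAt T d N → Captures N (C₁ , l₁) (C₂ , l₂) →
            (∀ {d′ N′} → NodeAt T d′ N′ → Captures N′ (C₁ , l₁) (C₂ , l₂) → d′ ℕ.≤ d) →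
            Outcome (merge at ok)
              ((N ∩ (C₁ ∪ C₂) , pure) ∷
               keepNonempty ((C₁ ─ N , l₁) ∷ (C₂ ─ N , l₂) ∷ []) ++ rest)

  splitCount mergeCount : ∀ {cs} → Request cs → ℕ
  splitCount (split _ _) = 1
  splitCount (merge _ _) = 0
  mergeCount (split _ _) = 0
  mergeCount (merge _ _) = 1

  -- Run s m cs: some sequence of s split and m merge requests, in any order,
  -- leads from the initial clustering to cs.
  data Run : ℕ → ℕ → State n → Set (ℓ₁ ⊔ ℓ₂) where
    start : Run 0 0 initial
    step  : ∀ {s m cs cs′} → Run s m cs → (q : Request cs) → Outcome q cs′ →
            Run (splitCount q ℕ.+ s) (mergeCount q ℕ.+ m) cs′

module Submission where

-- Strict separation makes average linkage respect every target cluster B: as long as B is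
-- scattered over several trees, no merge across its boundary has maximal average similarity.
-- Hence B ∩ Y is a node of the tree of Y.  A split therefore distributes whole pieces C ∩ B over
-- the two children and lowers the overclustering error, and a merge extracts a subset of a
-- single target.
--
-- For merges, give each pure cluster charge 1 and each impure cluster C the charge
-- Σ_B log ∣B ∩ C∣, where log s is the least t with s < b ^ t.  A merge removes at least one unit
-- of charge from each of its two clusters (a pure one is absorbed, an impure one loses a fraction η
-- of one of its pieces) and creates one unit, so the total charge strictly decreases.  Initially
-- it is at most log n times the number δᵤ + k of pieces.

open import Defs
open import Data.Fin using (Fin; zero; suc)
open import Data.Fin.Subset
  using (Subset; inside; outside; _∈_; _∉_; _⊆_; _∩_; _∪_; _─_; ⁅_⁆; ∣_∣; Nonempty; Empty)
open import Data.Fin.Subset.Properties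
open import Data.List using (List; []; _∷_; _++_; map; filter; foldr; length; allFin; tabulate)
open import Data.List.Membership.Propositional using (find) renaming (_∈_ to _∈ˡ_)
open import Data.List.Membership.Propositional.Properties
  using (∈-filter⁺; ∈-filter⁻; ∈-∃++; ∈-map⁺; ∈-map⁻; ∈-++⁺ˡ; ∈-++⁺ʳ; ∈-++⁻; ∈-allFin)
open import Data.List.Properties
  using (filter-accept; filter-reject; filter-all; filter-none; filter-some; filter-++;
         map-++; map-∘; map-tabulate; length-map)
open import Data.List.Relation.Binary.Permutation.Propositional
  using (_↭_; ↭-refl; ↭-sym; ↭-trans; ↭-prep; ↭-swap; ↭⇒↭ₛ)
open import Data.List.Relation.Binary.Permutation.Propositional.Properties
  using (All-resp-↭; Any-resp-↭; ∈-resp-↭; map⁺; shift; drop-∷; ↭-length; ¬x∷xs↭[])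
import Data.List.Relation.Binary.Permutation.Setoid.Properties as Permutationₛ
open import Data.List.Relation.Unary.All as All using (All; []; _∷_)
import Data.List.Relation.Unary.All.Properties as Allₚ
open import Data.List.Relation.Unary.AllPairs as AllPairs using (AllPairs; []; _∷_)
import Data.List.Relation.Unary.AllPairs.Properties as AllPairsₚ
open import Data.List.Relation.Unary.Any as Any using (Any; here; there; any?)
import Data.List.Relation.Unary.Any.Properties as Anyₚ
import Data.List.Relation.Unary.Unique.Propositional.Properties as Uniqueₚ
open import Data.Nat as ℕ using (ℕ; zero; suc; _∸_; z≤n; s≤s)
import Data.Nat.Properties as ℕₚ
open import Data.Nat.ListAction using (sum)
open import Data.Nat.ListAction.Properties using (sum-++; sum-↭)
open import Data.Product using (_×_; _,_; proj₁; proj₂; ∃-syntax; uncurry)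
open import Data.Sum using (_⊎_; inj₁; inj₂; [_,_]′)
open import Data.Unit using (⊤; tt)
open import Data.Vec using ([]; _∷_; here; there)
open import Function using (_∘_; id; _on_)
open import Function.Bundles using (mk⇔)
open import Relation.Binary.Bundles using (StrictTotalOrder; TotalOrder; DecTotalOrder)
open import Relation.Binary.Core using (Rel)
open import Relation.Binary.Definitions using (Symmetric; tri<; tri≈; tri>)
open import Relation.Binary.PropositionalEquality as ≡ using (_≡_; _≢_)
open import Relation.Nullary using (¬_; Dec; yes; no; contradiction)
open import Relation.Nullary.Decidable using (_×-dec_)
open import Relation.Unary using (Pred; Decidable)

-- Finite subsets

-- The inequality 2η > 1 is used twice. It makes the node chosen by a merge share a point with the
-- target that licenses the merge, so that maximal depth confines the node to that target; and it
-- gives b = 1/(1 - η) ≥ 2. The labels matter because a pure cluster lies in one target: it is never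
-- split, and its threshold 1 makes a merge swallow it whole, so charge 1 is enough however large it
-- is. The two counts do not interfere: a split keeps every piece intact, hence preserves the
-- charge, and a merge creates a cluster without excess. The factor 2 pays for rounding, since for s
-- ≥ 1 `log s` is the floor of log_b s plus one. If b is huge, log_b n is close to 0 while a merge
-- may be unavoidable (two points, one target, two initial singletons). Hence the bound by log_b n
-- itself is stated for b ≤ n², and for every b the logarithm is rounded up. Bounds on runs alone
-- would allow a process that gets stuck, so it is also shown that every state is the target or
-- admits a request, and that every request has an outcome.

Disjoint : ∀ {n} → Rel (Subset n) _
Disjoint A B = Empty (A ∩ B)

disjoint-sym : ∀ {n} → Symmetric (Disjoint {n})
disjoint-sym {_} {A} {B} A∩B=∅ (x , x∈B∩A) =
  let x∈B , x∈A = x∈p∩q⁻ B A x∈B∩A in A∩B=∅ (x , x∈p∩q⁺ (x∈A , x∈B))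

disjoint-∉ : ∀ {n} {A B : Subset n} → Disjoint A B → ∀ {x} → x ∈ A → x ∉ B
disjoint-∉ A∩B=∅ x∈A x∈B = A∩B=∅ (_ , x∈p∩q⁺ (x∈A , x∈B))

disjoint-⊆ : ∀ {n} {A A′ B B′ : Subset n} → A′ ⊆ A → B′ ⊆ B → Disjoint A B → Disjoint A′ B′
disjoint-⊆ {_} {A} {A′} {B} {B′} A′⊆A B′⊆B A∩B=∅ (x , x∈A′∩B′) =
  let x∈A′ , x∈B′ = x∈p∩q⁻ A′ B′ x∈A′∩B′ in disjoint-∉ A∩B=∅ (A′⊆A x∈A′) (B′⊆B x∈B′)

disjoint-∪ : ∀ {n} {A B C : Subset n} → Disjoint A C → Disjoint B C → Disjoint (A ∪ B) C
disjoint-∪ {_} {A} {B} {C} A∩C=∅ B∩C=∅ (x , x∈) =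
  let x∈A∪B , x∈C = x∈p∩q⁻ (A ∪ B) C x∈
  in [ (λ x∈A → disjoint-∉ A∩C=∅ x∈A x∈C) , (λ x∈B → disjoint-∉ B∩C=∅ x∈B x∈C) ]′
       (x∈p∪q⁻ A B x∈A∪B)

∪-⊆ : ∀ {n} {A B C : Subset n} → A ⊆ C → B ⊆ C → A ∪ B ⊆ C
∪-⊆ {_} {A} {B} A⊆C B⊆C x∈A∪B = [ A⊆C , B⊆C ]′ (x∈p∪q⁻ A B x∈A∪B)

∩-monoʳ : ∀ {n} {A B C : Subset n} → A ⊆ B → C ∩ A ⊆ C ∩ B
∩-monoʳ {_} {A} {B} {C} A⊆B x∈ = let x∈C , x∈A = x∈p∩q⁻ C A x∈ in x∈p∩q⁺ (x∈C , A⊆B x∈A)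

x∈p─q⇒x∉q : ∀ {n} (p q : Subset n) {x} → x ∈ p ─ q → x ∉ q
x∈p─q⇒x∉q (_ ∷ p) (inside  ∷ q) (there x∈) (there x∈q) = x∈p─q⇒x∉q p q x∈ x∈q
x∈p─q⇒x∉q (_ ∷ p) (outside ∷ q) (there x∈) (there x∈q) = x∈p─q⇒x∉q p q x∈ x∈q

∣p∣≡∣q∩p∣+∣p─q∣ : ∀ {n} (p q : Subset n) → ∣ p ∣ ≡ ∣ q ∩ p ∣ ℕ.+ ∣ p ─ q ∣
∣p∣≡∣q∩p∣+∣p─q∣ [] [] = ≡.refl
∣p∣≡∣q∩p∣+∣p─q∣ (inside  ∷ p) (inside  ∷ q) = ≡.cong suc (∣p∣≡∣q∩p∣+∣p─q∣ p q)
∣p∣≡∣q∩p∣+∣p─q∣ (inside  ∷ p) (outside ∷ q) =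
  ≡.trans (≡.cong suc (∣p∣≡∣q∩p∣+∣p─q∣ p q)) (≡.sym (ℕₚ.+-suc _ _))
∣p∣≡∣q∩p∣+∣p─q∣ (outside ∷ p) (inside  ∷ q) = ∣p∣≡∣q∩p∣+∣p─q∣ p q
∣p∣≡∣q∩p∣+∣p─q∣ (outside ∷ p) (outside ∷ q) = ∣p∣≡∣q∩p∣+∣p─q∣ p q

disjoint-∣∣ : ∀ {n} {P Q A : Subset n} → P ⊆ A → Q ⊆ A → Disjoint P Q →
              ∣ P ∣ ℕ.+ ∣ Q ∣ ℕ.≤ ∣ A ∣
disjoint-∣∣ {_} {P} {Q} {A} P⊆A Q⊆A P∩Q=∅ =
  ≡.subst (∣ P ∣ ℕ.+ ∣ Q ∣ ℕ.≤_) (≡.sym (∣p∣≡∣q∩p∣+∣p─q∣ A P))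
    (ℕₚ.+-mono-≤ (p⊆q⇒∣p∣≤∣q∣ (λ x∈P → x∈p∩q⁺ (x∈P , P⊆A x∈P)))
                 (p⊆q⇒∣p∣≤∣q∣ (λ x∈Q → x∈p∧x∉q⇒x∈p─q (Q⊆A x∈Q)
                                          (disjoint-∉ (disjoint-sym P∩Q=∅) x∈Q))))

nonempty⇒0<∣∣ : ∀ {n} {p : Subset n} → Nonempty p → 0 ℕ.< ∣ p ∣
nonempty⇒0<∣∣ (x , x∈p) = ℕₚ.≤-<-trans z≤n (x∈p⇒∣p-x∣<∣p∣ x∈p)

empty⇒∣∣≡0 : ∀ {n} {p : Subset n} → Empty p → ∣ p ∣ ≡ 0
empty⇒∣∣≡0 {n} p=∅ = ≡.trans (≡.cong ∣_∣ (Empty-unique p=∅)) (∣⊥∣≡0 n)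

0<∣∣⇒nonempty : ∀ {n} {p : Subset n} → 0 ℕ.< ∣ p ∣ → Nonempty p
0<∣∣⇒nonempty {p = p} 0<∣p∣ with nonempty? p
... | yes p≠∅ = p≠∅
... | no  p=∅ = contradiction (≡.subst (0 ℕ.<_) (empty⇒∣∣≡0 p=∅) 0<∣p∣) λ ()

∈-elements⁺ : ∀ {n} {A : Subset n} {x} → x ∈ A → x ∈ˡ elements A
∈-elements⁺ {A = A} {x} x∈A = ∈-filter⁺ (_∈? A) (∈-allFin x) x∈A

∈-elements⁻ : ∀ {n} {A : Subset n} {x} → x ∈ˡ elements A → x ∈ A
∈-elements⁻ {n} {A} x∈ = proj₂ (∈-filter⁻ (_∈? A) {xs = allFin n} x∈)

-- Lists

open import Algebra.Properties.CommutativeSemigroup ℕₚ.+-commutativeSemigroup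
  using () renaming (interchange to ℕ+-interchange)

module _ {a} {A : Set a} where

  AllPairs-resp-↭ : ∀ {r} {R : Rel A r} → Symmetric R → ∀ {xs ys} → xs ↭ ys →
                    AllPairs R xs → AllPairs R ys
  AllPairs-resp-↭ {R = R} R-sym xs↭ys =
    Permutationₛ.AllPairs-resp-↭ (≡.setoid A) R-sym (≡.resp₂ R) (↭⇒↭ₛ xs↭ys)

  ∈⇒↭∷ : ∀ {x : A} {xs} → x ∈ˡ xs → ∃[ ys ] xs ↭ x ∷ ys
  ∈⇒↭∷ {x} x∈xs with ys , zs , ≡.refl ← ∈-∃++ x∈xs = ys ++ zs , shift x ys zs

  AllPairs-∈ : ∀ {r} {R : Rel A r} → Symmetric R → ∀ {xs x y} → AllPairs R xs →
               x ∈ˡ xs → y ∈ˡ xs → x ≡ y ⊎ R x y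
  AllPairs-∈ R-sym (Rx ∷ Rxs) (here ≡.refl) (here ≡.refl) = inj₁ ≡.refl
  AllPairs-∈ R-sym (Rx ∷ Rxs) (here ≡.refl) (there y∈)  = inj₂ (All.lookup Rx y∈)
  AllPairs-∈ R-sym (Rx ∷ Rxs) (there x∈)  (here ≡.refl) = inj₂ (R-sym (All.lookup Rx x∈))
  AllPairs-∈ R-sym (Rx ∷ Rxs) (there x∈)  (there y∈)  = AllPairs-∈ R-sym Rxs x∈ y∈

  length≤1⇒≡ : ∀ {xs : List A} {x y} → length xs ℕ.≤ 1 → x ∈ˡ xs → y ∈ˡ xs → x ≡ y
  length≤1⇒≡ {_ ∷ []} _ (here ≡.refl) (here ≡.refl) = ≡.refl
  length≤1⇒≡ {_ ∷ _ ∷ _} (s≤s ()) _ _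

  -- Turns a choice made cluster by cluster into the global alternative of `progress`: all clusters
  -- are targets, or one of them yields a request.
  All-⊎ : ∀ {p q} {P : Pred A p} {Q : Set q} {xs} → All (λ x → P x ⊎ Q) xs → All P xs ⊎ Q
  All-⊎ [] = inj₁ []
  All-⊎ (inj₂ q ∷ _) = inj₂ q
  All-⊎ (inj₁ p ∷ ps) with All-⊎ ps
  ... | inj₁ ps′ = inj₁ (p ∷ ps′)
  ... | inj₂ q   = inj₂ q

  sum-map-≤ : ∀ {f g : A → ℕ} xs → (∀ {x} → x ∈ˡ xs → f x ℕ.≤ g x) →
              sum (map f xs) ℕ.≤ sum (map g xs)
  sum-map-≤ []       f≤g = z≤n
  sum-map-≤ (x ∷ xs) f≤g = ℕₚ.+-mono-≤ (f≤g (here ≡.refl)) (sum-map-≤ xs (f≤g ∘ there))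

  sum-map-cong : ∀ {f g : A → ℕ} xs → (∀ {x} → x ∈ˡ xs → f x ≡ g x) →
                 sum (map f xs) ≡ sum (map g xs)
  sum-map-cong []       f≡g = ≡.refl
  sum-map-cong (x ∷ xs) f≡g = ≡.cong₂ ℕ._+_ (f≡g (here ≡.refl)) (sum-map-cong xs (f≡g ∘ there))

  sum-map-< : ∀ {f g : A → ℕ} {xs y} → y ∈ˡ xs → f y ℕ.< g y →
              (∀ {x} → x ∈ˡ xs → f x ℕ.≤ g x) → sum (map f xs) ℕ.< sum (map g xs)
  sum-map-< {xs = _ ∷ xs} (here ≡.refl) fy<gy f≤g =
    ℕₚ.+-mono-<-≤ fy<gy (sum-map-≤ xs (f≤g ∘ there))
  sum-map-< (there y∈) fy<gy f≤g =
    ℕₚ.+-mono-≤-< (f≤g (here ≡.refl)) (sum-map-< y∈ fy<gy (f≤g ∘ there))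

  sum-map-+ : ∀ (f g : A → ℕ) xs →
              sum (map (λ x → f x ℕ.+ g x) xs) ≡ sum (map f xs) ℕ.+ sum (map g xs)
  sum-map-+ f g []       = ≡.refl
  sum-map-+ f g (x ∷ xs) =
    ≡.trans (≡.cong (f x ℕ.+ g x ℕ.+_) (sum-map-+ f g xs)) (ℕ+-interchange (f x) (g x) _ _)

  sum-map-* : ∀ (f : A → ℕ) L xs → sum (map (λ x → f x ℕ.* L) xs) ≡ sum (map f xs) ℕ.* L
  sum-map-* f L []       = ≡.refl
  sum-map-* f L (x ∷ xs) =
    ≡.trans (≡.cong (f x ℕ.* L ℕ.+_) (sum-map-* f L xs)) (≡.sym (ℕₚ.*-distribʳ-+ L (f x) _))

  sum-map-0 : ∀ (xs : List A) → sum (map (λ _ → 0) xs) ≡ 0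
  sum-map-0 []       = ≡.refl
  sum-map-0 (x ∷ xs) = sum-map-0 xs

sum-map-swap : ∀ {a b} {A : Set a} {B : Set b} (f : A → B → ℕ) xs ys →
               sum (map (λ x → sum (map (f x) ys)) xs) ≡
               sum (map (λ y → sum (map (λ x → f x y) xs)) ys)
sum-map-swap f []       ys = ≡.sym (sum-map-0 ys)
sum-map-swap f (x ∷ xs) ys =
  ≡.trans (≡.cong (sum (map (f x) ys) ℕ.+_) (sum-map-swap f xs ys)) (≡.sym (sum-map-+ _ _ ys))

-- Source of the strict drop of `excess` under a split: the hits of the children add up to those of
-- the parent, but 1 is subtracted twice instead of once.
∸1+∸1 : ∀ {a b c} → 1 ℕ.≤ a → 1 ℕ.≤ b → a ℕ.+ b ℕ.≤ c →
        suc ((a ∸ 1) ℕ.+ (b ∸ 1)) ℕ.≤ c ∸ 1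
∸1+∸1 {suc a} {suc b} {suc c} (s≤s _) (s≤s _) (s≤s a+b≤c) =
  ≡.subst (ℕ._≤ c) (ℕₚ.+-suc a b) a+b≤c

length-elements : ∀ {n} (A : Subset n) → length (elements A) ≡ ∣ A ∣
length-elements {zero} [] = ≡.refl
length-elements {suc n} (s ∷ A) = head s
  where
  tail-≡ : ∀ s → length (filter (_∈? (s ∷ A)) (tabulate suc)) ≡ ∣ A ∣
  tail-≡ s = ≡.trans (≡.cong (length ∘ filter (_∈? (s ∷ A))) (≡.sym (map-tabulate id suc)))
             (≡.trans (shifted (allFin n)) (length-elements A))
    where
    shifted : ∀ xs → length (filter (_∈? (s ∷ A)) (map suc xs)) ≡ length (filter (_∈? A) xs)
    shifted [] = ≡.refl
    shifted (x ∷ xs) with x ∈? A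
    ... | yes _ = ≡.cong suc (shifted xs)
    ... | no  _ = shifted xs
  head : ∀ s → length (elements (s ∷ A)) ≡ ∣ s ∷ A ∣
  head inside  = ≡.cong suc (tail-≡ inside)
  head outside = tail-≡ outside

-- One formula serves both potentials: with `sgn` it counts the members of `Bs` that meet `A`
-- (`length-meeting`), with `log` it is the charge of an impure cluster.
mass : ∀ {n} → (ℕ → ℕ) → List (Subset n) → Subset n → ℕ
mass f Bs A = sum (map (λ B → f ∣ B ∩ A ∣) Bs)

sgn : ℕ → ℕ
sgn zero    = 0
sgn (suc _) = 1

sgn-mono : ∀ {i j} → i ℕ.≤ j → sgn i ℕ.≤ sgn j
sgn-mono {zero}              _ = z≤n
sgn-mono {suc i} {suc j} (s≤s _) = s≤s z≤n

meeting : ∀ {n} → List (Subset n) → Subset n → List (Subset n)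
meeting Bs A = filter (λ B → nonempty? (B ∩ A)) Bs

length-meeting : ∀ {n} (Bs : List (Subset n)) A → length (meeting Bs A) ≡ mass sgn Bs A
length-meeting []       A = ≡.refl
length-meeting (B ∷ Bs) A with nonempty? (B ∩ A)
... | yes B∩A≠∅ with suc _ ← ∣ B ∩ A ∣ | s≤s _ ← nonempty⇒0<∣∣ B∩A≠∅ =
  ≡.cong suc (length-meeting Bs A)
... | no B∩A=∅ rewrite empty⇒∣∣≡0 B∩A=∅ = length-meeting Bs A

mass-mono : ∀ {n f} → (∀ {i j} → i ℕ.≤ j → f i ℕ.≤ f j) → (Bs : List (Subset n)) →
            ∀ {A A′} → A ⊆ A′ → mass f Bs A ℕ.≤ mass f Bs A′
mass-mono f-mono Bs A⊆A′ =
  sum-map-≤ Bs (λ {B} _ → f-mono (p⊆q⇒∣p∣≤∣q∣ (∩-monoʳ {C = B} A⊆A′)))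

-- No `B` straddles the two parts, so in each pair of summands one is `f 0` = 0 and the other sees
-- the whole piece.
mass-split : ∀ {n} f → f 0 ≡ 0 → (Bs : List (Subset n)) → ∀ {A₁ A₂} →
             (∀ {B} → B ∈ˡ Bs → Disjoint B A₁ ⊎ Disjoint B A₂) →
             mass f Bs A₁ ℕ.+ mass f Bs A₂ ≡ mass f Bs (A₁ ∪ A₂)
mass-split f f0≡0 Bs {A₁} {A₂} clean =
  ≡.trans (≡.sym (sum-map-+ _ _ Bs)) (sum-map-cong Bs (λ B∈ → piece (clean B∈)))
  where
  piece : ∀ {B} → Disjoint B A₁ ⊎ Disjoint B A₂ →
          f ∣ B ∩ A₁ ∣ ℕ.+ f ∣ B ∩ A₂ ∣ ≡ f ∣ B ∩ (A₁ ∪ A₂) ∣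
  piece {B} (inj₁ B∩A₁=∅) rewrite empty⇒∣∣≡0 B∩A₁=∅ | f0≡0 =
    ≡.cong (f ∘ ∣_∣) (⊆-antisym (∩-monoʳ (q⊆p∪q A₁ A₂)) λ x∈ →
      let x∈B , x∈A = x∈p∩q⁻ B (A₁ ∪ A₂) x∈ in
      [ (λ x∈A₁ → contradiction x∈A₁ (disjoint-∉ B∩A₁=∅ x∈B)) , (λ x∈A₂ → x∈p∩q⁺ (x∈B , x∈A₂)) ]′
        (x∈p∪q⁻ A₁ A₂ x∈A))
  piece {B} (inj₂ B∩A₂=∅) rewrite empty⇒∣∣≡0 B∩A₂=∅ | f0≡0 =
    ≡.trans (ℕₚ.+-identityʳ _)
    (≡.cong (f ∘ ∣_∣) (⊆-antisym (∩-monoʳ (p⊆p∪q A₂)) λ x∈ →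
      let x∈B , x∈A = x∈p∩q⁻ B (A₁ ∪ A₂) x∈ in
      [ (λ x∈A₁ → x∈p∩q⁺ (x∈B , x∈A₁)) , (λ x∈A₂ → contradiction x∈A₂ (disjoint-∉ B∩A₂=∅ x∈B)) ]′
        (x∈p∪q⁻ A₁ A₂ x∈A)))

-- Clusters meeting a given set

module _ {n} (𝒞 : Clustering n) where
  open Clustering 𝒞 using (nonempty; disjoint; covers)

  cluster-≡ : ∀ {A B} → A ∈ˡ clusters 𝒞 → B ∈ˡ clusters 𝒞 → ∀ {x} → x ∈ A → x ∈ B → A ≡ B
  cluster-≡ A∈ B∈ x∈A x∈B with AllPairs-∈ disjoint-sym disjoint A∈ B∈
  ... | inj₁ A≡B   = A≡B
  ... | inj₂ A∩B=∅ = contradiction x∈B (disjoint-∉ A∩B=∅ x∈A)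

  cluster-of : ∀ x → ∃[ B ] (B ∈ˡ clusters 𝒞 × x ∈ B)
  cluster-of x = let B , B∈ , x∈B = find (covers x) in B , B∈ , x∈B

  hits≥1 : ∀ {A} → Nonempty A → 1 ℕ.≤ hits 𝒞 A
  hits≥1 {A} (x , x∈A) =
    filter-some (λ B → nonempty? (B ∩ A)) (Any.map (λ x∈B → x , x∈p∩q⁺ (x∈B , x∈A)) (covers x))

  hits≤1⇒≡ : ∀ {A B B′} → hits 𝒞 A ℕ.≤ 1 → B ∈ˡ clusters 𝒞 → B′ ∈ˡ clusters 𝒞 →
             Nonempty (B ∩ A) → Nonempty (B′ ∩ A) → B ≡ B′
  hits≤1⇒≡ {A} hits≤1 B∈ B′∈ B∩A≠∅ B′∩A≠∅ =
    length≤1⇒≡ hits≤1 (∈-filter⁺ (λ B → nonempty? (B ∩ A)) B∈ B∩A≠∅)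
                      (∈-filter⁺ (λ B → nonempty? (B ∩ A)) B′∈ B′∩A≠∅)

  hits≤1⇒⊆ : ∀ {A} → Nonempty A → hits 𝒞 A ℕ.≤ 1 → ∃[ B ] (B ∈ˡ clusters 𝒞 × A ⊆ B)
  hits≤1⇒⊆ {A} (x , x∈A) hits≤1 with B , B∈ , x∈B ← cluster-of x = B , B∈ , A⊆B
    where
    A⊆B : A ⊆ B
    A⊆B {y} y∈A with B′ , B′∈ , y∈B′ ← cluster-of y =
      ≡.subst (y ∈_) (hits≤1⇒≡ hits≤1 B′∈ B∈ (y , x∈p∩q⁺ (y∈B′ , y∈A)) (x , x∈p∩q⁺ (x∈B , x∈A))) y∈B′

  -- The first cluster found to meet `A` shares a point with `B`, hence is `B`; the later ones are
  -- disjoint from it and so miss `A`.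
  ⊆⇒hits≤1 : ∀ {A B} → B ∈ˡ clusters 𝒞 → A ⊆ B → hits 𝒞 A ℕ.≤ 1
  ⊆⇒hits≤1 {A} {B} B∈ A⊆B = at-most-one (clusters 𝒞) id disjoint
    where
    at-most-one : ∀ Bs → (∀ {B′} → B′ ∈ˡ Bs → B′ ∈ˡ clusters 𝒞) → AllPairs Disjoint Bs →
                  length (meeting Bs A) ℕ.≤ 1
    at-most-one []        _     _ = z≤n
    at-most-one (B′ ∷ Bs) incl (B′# ∷ #) with nonempty? (B′ ∩ A)
    ... | no  _            = at-most-one Bs (incl ∘ there) #
    ... | yes (x , x∈B′∩A) = s≤s (ℕₚ.≤-reflexive (≡.cong length
            (filter-none (λ B → nonempty? (B ∩ A)) (All.map misses B′#))))
      where
      B⊆B′ : B ⊆ B′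
      B⊆B′ = let x∈B′ , x∈A = x∈p∩q⁻ B′ A x∈B′∩A
             in ⊆-reflexive (cluster-≡ B∈ (incl (here ≡.refl)) (A⊆B x∈A) x∈B′)
      misses : ∀ {B″} → Disjoint B′ B″ → Disjoint B″ A
      misses B′∩B″=∅ = disjoint-sym (disjoint-⊆ (B⊆B′ ∘ A⊆B) id B′∩B″=∅)

  -- Clusters are disjoint and `N ⊆ B`, so only the piece in `B` changes: any `B′` meeting `N` is
  -- `B` itself.
  mass-shrink : ∀ f {B C N} → B ∈ˡ clusters 𝒞 → N ⊆ B → f ∣ B ∩ (C ─ N) ∣ ℕ.< f ∣ B ∩ C ∣ →
                mass f (clusters 𝒞) (C ─ N) ℕ.< mass f (clusters 𝒞) C
  mass-shrink f {B} {C} {N} B∈ N⊆B f< = sum-map-< B∈ f< piece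
    where
    piece : ∀ {B′} → B′ ∈ˡ clusters 𝒞 → f ∣ B′ ∩ (C ─ N) ∣ ℕ.≤ f ∣ B′ ∩ C ∣
    piece {B′} B′∈ with nonempty? (B′ ∩ N)
    ... | yes (x , x∈) with ≡.refl ← (let x∈B′ , x∈N = x∈p∩q⁻ B′ N x∈
                                    in cluster-≡ B∈ B′∈ (N⊆B x∈N) x∈B′) = ℕₚ.<⇒≤ f<
    ... | no B′∩N=∅ = ℕₚ.≤-reflexive (≡.cong (f ∘ ∣_∣) (⊆-antisym (∩-monoʳ (p─q⊆p C N)) λ x∈ →
            let x∈B′ , x∈C = x∈p∩q⁻ B′ C x∈
            in x∈p∩q⁺ (x∈B′ , x∈p∧x∉q⇒x∈p─q x∈C (disjoint-∉ B′∩N=∅ x∈B′))))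

-- Double counting of the nonempty pieces `B ∩ A`: from the side of `𝒞′` their number is the sum of
-- the hits, that is `dist 𝒞′ 𝒞 + size 𝒞′`, and each contributes at most `L`. With `𝒞′` the target
-- this is the origin of δᵤ + k.
sum-mass : ∀ {n} (𝒞 𝒞′ : Clustering n) f L → f 0 ≡ 0 → (∀ A → f ∣ A ∣ ℕ.≤ L) →
           sum (map (mass f (clusters 𝒞′)) (clusters 𝒞)) ℕ.≤ (dist 𝒞′ 𝒞 ℕ.+ size 𝒞′) ℕ.* L
sum-mass 𝒞 𝒞′ f L f0≡0 f≤L = begin
  sum (map (λ A → sum (map (λ B → f ∣ B ∩ A ∣) Bs)) As)
    ≤⟨ sum-map-≤ As (λ {A} _ → sum-map-≤ Bs (λ {B} _ → f≤sgn (B ∩ A))) ⟩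
  sum (map (λ A → sum (map (λ B → sgn ∣ B ∩ A ∣ ℕ.* L) Bs)) As)
    ≡⟨ sum-map-swap _ As Bs ⟩
  sum (map (λ B → sum (map (λ A → sgn ∣ B ∩ A ∣ ℕ.* L) As)) Bs)
    ≡⟨ sum-map-cong Bs (λ {B} _ → ≡.trans (sum-map-* _ L As) (≡.cong (ℕ._* L)
         (≡.trans (sum-map-cong As (λ {A} _ → ≡.cong (sgn ∘ ∣_∣) (∩-comm B A)))
                (≡.sym (length-meeting As B))))) ⟩
  sum (map (λ B → hits 𝒞 B ℕ.* L) Bs)
    ≡⟨ sum-map-* _ L Bs ⟩
  sum (map (hits 𝒞) Bs) ℕ.* L
    ≡⟨ ≡.cong (ℕ._* L) (sum-pred Bs (λ B∈ → hits≥1 𝒞 (All.lookup (Clustering.nonempty 𝒞′) B∈))) ⟩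
  (dist 𝒞′ 𝒞 ℕ.+ size 𝒞′) ℕ.* L ∎
  where
  open ℕₚ.≤-Reasoning
  As = clusters 𝒞
  Bs = clusters 𝒞′
  f≤sgn : ∀ P → f ∣ P ∣ ℕ.≤ sgn ∣ P ∣ ℕ.* L
  f≤sgn P with ∣ P ∣ | f≤L P
  ... | zero  | _   = ℕₚ.≤-reflexive f0≡0
  ... | suc _ | f≤L = ℕₚ.≤-trans f≤L (ℕₚ.≤-reflexive (≡.sym (ℕₚ.*-identityˡ L)))
  sum-pred : ∀ {h : Subset _ → ℕ} Bs → (∀ {B} → B ∈ˡ Bs → 1 ℕ.≤ h B) →
             sum (map h Bs) ≡ sum (map (λ B → h B ∸ 1) Bs) ℕ.+ length Bs
  sum-pred []       h≥1 = ≡.refl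
  sum-pred {h} (B ∷ Bs) h≥1 =
    ≡.trans (≡.cong₂ ℕ._+_ (≡.sym (ℕₚ.m∸n+n≡m (h≥1 (here ≡.refl)))) (sum-pred Bs (h≥1 ∘ there)))
          (ℕ+-interchange (h B ∸ 1) 1 _ (length Bs))

-- Ordered fields

module OrderedFieldProperties {c ℓ₁ ℓ₂} (F : OrderedField c ℓ₁ ℓ₂) where
  open OrderedField F hiding (zero)

  AtLeastTwo : Carrier → Set _
  AtLeastTwo x = 1# + 1# ≤ x

  MoreThanHalf : Carrier → Set _
  MoreThanHalf x = (1# + 1#) ⁻¹ < x

  strictTotalOrder : StrictTotalOrder c ℓ₁ ℓ₂
  strictTotalOrder = record { isStrictTotalOrder = isStrictTotalOrder }

  open StrictTotalOrder strictTotalOrder public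
    using (strictPartialOrder; compare; <-respʳ-≈)
    renaming (irrefl to <-irrefl; trans to <-trans; asym to <-asym)
  open import Relation.Binary.Properties.StrictTotalOrder strictTotalOrder public
    using (decTotalOrder)
  open DecTotalOrder decTotalOrder public
    using (totalOrder; _≤?_)
    renaming (refl to ≤-refl; trans to ≤-trans; reflexive to ≤-reflexive)
  open import Relation.Binary.Reasoning.StrictPartialOrder strictPartialOrder public
  open import Algebra.Properties.Semiring.Mult semiring public
    using (×-homo-+; ×1-homo-*)
  open import Algebra.Properties.Semiring.Exp semiring public
    using (^-congˡ; ^-homo-*; ^-assocʳ)
  open import Algebra.Properties.Group +-group using (//-rightDividesˡ)

  <⇒≤ : ∀ {x y} → x < y → x ≤ y
  <⇒≤ = inj₁

  <⇒≱ : ∀ {x y} → x < y → ¬ (y ≤ x)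
  <⇒≱ x<y (inj₁ y<x) = <-asym x<y y<x
  <⇒≱ x<y (inj₂ y≈x) = <-irrefl (sym y≈x) x<y

  ≰⇒> : ∀ {x y} → ¬ (x ≤ y) → y < x
  ≰⇒> {x} {y} x≰y with compare x y
  ... | tri< x<y _ _ = contradiction (inj₁ x<y) x≰y
  ... | tri≈ _ x≈y _ = contradiction (inj₂ x≈y) x≰y
  ... | tri> _ _ y<x = y<x

  +-monoʳ-≤ : ∀ x {y z} → y ≤ z → x + y ≤ x + z
  +-monoʳ-≤ x (inj₁ y<z) = inj₁ (+-monoʳ-< x y<z)
  +-monoʳ-≤ x (inj₂ y≈z) = inj₂ (+-congˡ y≈z)

  +-monoˡ-≤ : ∀ z {x y} → x ≤ y → x + z ≤ y + z
  +-monoˡ-≤ z {x} {y} x≤y = begin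
    x + z  ≈⟨ +-comm x z ⟩
    z + x  ≤⟨ +-monoʳ-≤ z x≤y ⟩
    z + y  ≈⟨ +-comm z y ⟩
    y + z  ∎

  +-mono-≤ : ∀ {w x y z} → w ≤ x → y ≤ z → w + y ≤ x + z
  +-mono-≤ {w} {x} {y} {z} w≤x y≤z = ≤-trans (+-monoˡ-≤ y w≤x) (+-monoʳ-≤ x y≤z)

  +-mono-<-≤ : ∀ {w x y z} → w < x → y ≤ z → w + y < x + z
  +-mono-<-≤ {w} {x} {y} {z} w<x y≤z = begin-strict
    w + y  ≤⟨ +-monoʳ-≤ w y≤z ⟩
    w + z  ≈⟨ +-comm w z ⟩
    z + w  <⟨ +-monoʳ-< z w<x ⟩
    z + x  ≈⟨ +-comm z x ⟩
    x + z  ∎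

  +-cancelˡ-≤ : ∀ x {y z} → x + y ≤ x + z → y ≤ z
  +-cancelˡ-≤ x {y} {z} x+y≤x+z with y ≤? z
  ... | yes y≤z = y≤z
  ... | no  y≰z = contradiction x+y≤x+z (<⇒≱ (+-monoʳ-< x (≰⇒> y≰z)))

  x<y⇒0<y-x : ∀ {x y} → x < y → 0# < y - x
  x<y⇒0<y-x {x} {y} x<y = begin-strict
    0#         ≈⟨ -‿inverseˡ x ⟨
    - x + x    <⟨ +-monoʳ-< (- x) x<y ⟩
    - x + y    ≈⟨ +-comm (- x) y ⟩
    y - x      ∎

  *-monoˡ-< : ∀ {z x y} → 0# < z → x < y → z * x < z * y
  *-monoˡ-< {z} {x} {y} 0<z x<y = begin-strict
    z * x                  ≈⟨ +-identityʳ _ ⟨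
    z * x + 0#             <⟨ +-monoʳ-< (z * x) (*-pos 0<z (x<y⇒0<y-x x<y)) ⟩
    z * x + z * (y - x)    ≈⟨ distribˡ z x (y - x) ⟨
    z * (x + (y - x))      ≈⟨ *-congˡ (+-comm x (y - x)) ⟩
    z * (y - x + x)        ≈⟨ *-congˡ (//-rightDividesˡ x y) ⟩
    z * y                  ∎

  *-monoʳ-< : ∀ {z x y} → 0# < z → x < y → x * z < y * z
  *-monoʳ-< {z} {x} {y} 0<z x<y = begin-strict
    x * z  ≈⟨ *-comm x z ⟩
    z * x  <⟨ *-monoˡ-< 0<z x<y ⟩
    z * y  ≈⟨ *-comm z y ⟩
    y * z  ∎

  *-monoˡ-≤ : ∀ {z x y} → 0# ≤ z → x ≤ y → z * x ≤ z * y
  *-monoˡ-≤ (inj₁ 0<z) (inj₁ x<y) = inj₁ (*-monoˡ-< 0<z x<y)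
  *-monoˡ-≤ _          (inj₂ x≈y) = inj₂ (*-congˡ x≈y)
  *-monoˡ-≤ {z} {x} {y} (inj₂ 0≈z) _ = begin
    z * x   ≈⟨ *-congʳ (sym 0≈z) ⟩
    0# * x  ≈⟨ zeroˡ x ⟩
    0#      ≈⟨ zeroˡ y ⟨
    0# * y  ≈⟨ *-congʳ 0≈z ⟩
    z * y   ∎

  *-monoʳ-≤ : ∀ {z x y} → 0# ≤ z → x ≤ y → x * z ≤ y * z
  *-monoʳ-≤ {z} {x} {y} 0≤z x≤y = begin
    x * z  ≈⟨ *-comm x z ⟩
    z * x  ≤⟨ *-monoˡ-≤ 0≤z x≤y ⟩
    z * y  ≈⟨ *-comm z y ⟩
    y * z  ∎

  *-mono-≤ : ∀ {w x y z} → 0# ≤ w → 0# ≤ y → w ≤ x → y ≤ z → w * y ≤ x * z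
  *-mono-≤ {w} {x} {y} {z} 0≤w 0≤y w≤x y≤z = begin
    w * y  ≤⟨ *-monoʳ-≤ 0≤y w≤x ⟩
    x * y  ≤⟨ *-monoˡ-≤ (≤-trans 0≤w w≤x) y≤z ⟩
    x * z  ∎

  *-cancelˡ-< : ∀ {z x y} → 0# ≤ z → z * x < z * y → x < y
  *-cancelˡ-< {z} {x} {y} 0≤z zx<zy with y ≤? x
  ... | yes y≤x = contradiction (*-monoˡ-≤ 0≤z y≤x) (<⇒≱ zx<zy)
  ... | no  y≰x = ≰⇒> y≰x

  0≤1 : 0# ≤ 1#
  0≤1 = <⇒≤ 0<1

  fromℕ-+ : ∀ i j → fromℕ (i ℕ.+ j) ≈ fromℕ i + fromℕ j
  fromℕ-+ = ×-homo-+ 1#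

  0≤fromℕ : ∀ i → 0# ≤ fromℕ i
  0≤fromℕ zero    = ≤-refl
  0≤fromℕ (suc i) = begin
    0#             ≈⟨ +-identityˡ 0# ⟨
    0# + 0#        ≤⟨ +-mono-≤ 0≤1 (0≤fromℕ i) ⟩
    1# + fromℕ i   ∎

  0<fromℕ : ∀ {i} → 0 ℕ.< i → 0# < fromℕ i
  0<fromℕ {suc i} _ = begin-strict
    0#             ≈⟨ +-identityˡ 0# ⟨
    0# + 0#        <⟨ +-mono-<-≤ 0<1 (0≤fromℕ i) ⟩
    1# + fromℕ i   ∎

  fromℕ-mono-≤ : ∀ {i j} → i ℕ.≤ j → fromℕ i ≤ fromℕ j
  fromℕ-mono-≤ {i} {j} i≤j = begin
    fromℕ i                    ≈⟨ +-identityʳ _ ⟨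
    fromℕ i + 0#               ≤⟨ +-monoʳ-≤ _ (0≤fromℕ (j ∸ i)) ⟩
    fromℕ i + fromℕ (j ∸ i)    ≈⟨ fromℕ-+ i (j ∸ i) ⟨
    fromℕ (i ℕ.+ (j ∸ i))      ≡⟨ ≡.cong fromℕ (ℕₚ.m+[n∸m]≡n i≤j) ⟩
    fromℕ j                    ∎

  fromℕ-cancel-≤ : ∀ {i j} → fromℕ i ≤ fromℕ j → i ℕ.≤ j
  fromℕ-cancel-≤ {i} {j} i≤j with i ℕₚ.≤? j
  ... | yes i≤j′ = i≤j′
  ... | no  i≰j  = contradiction i≤j (<⇒≱ (begin-strict
    fromℕ j          ≈⟨ +-identityˡ _ ⟨
    0# + fromℕ j     <⟨ +-mono-<-≤ 0<1 ≤-refl ⟩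
    fromℕ (suc j)    ≤⟨ fromℕ-mono-≤ (ℕₚ.≰⇒> i≰j) ⟩
    fromℕ i          ∎))

  fromℕ-1 : fromℕ 1 ≈ 1#
  fromℕ-1 = +-identityʳ 1#

  0≤^ : ∀ {x} → 0# ≤ x → ∀ i → 0# ≤ x ^ i
  0≤^ 0≤x zero    = 0≤1
  0≤^ {x} 0≤x (suc i) = begin
    0#          ≈⟨ zeroʳ x ⟨
    x * 0#      ≤⟨ *-monoˡ-≤ 0≤x (0≤^ 0≤x i) ⟩
    x * x ^ i   ∎

  1≤^ : ∀ {x} → 1# ≤ x → ∀ i → 1# ≤ x ^ i
  1≤^ 1≤x zero    = ≤-refl
  1≤^ {x} 1≤x (suc i) = begin
    1#          ≈⟨ *-identityˡ 1# ⟨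
    1# * 1#     ≤⟨ *-mono-≤ 0≤1 0≤1 1≤x (1≤^ 1≤x i) ⟩
    x * x ^ i   ∎

  ^-monoˡ-≤ : ∀ {x y} → 0# ≤ x → x ≤ y → ∀ i → x ^ i ≤ y ^ i
  ^-monoˡ-≤ 0≤x x≤y zero    = ≤-refl
  ^-monoˡ-≤ 0≤x x≤y (suc i) = *-mono-≤ 0≤x (0≤^ 0≤x i) x≤y (^-monoˡ-≤ 0≤x x≤y i)

  ^-monoʳ-≤ : ∀ {x} → 1# ≤ x → ∀ {i j} → i ℕ.≤ j → x ^ i ≤ x ^ j
  ^-monoʳ-≤ 1≤x {j = j} z≤n = 1≤^ 1≤x j
  ^-monoʳ-≤ 1≤x (s≤s i≤j)   = *-monoˡ-≤ (≤-trans 0≤1 1≤x) (^-monoʳ-≤ 1≤x i≤j)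

-- The potential of a piece of s points: log s is the least t with s < b ^ t, so that it
-- drops whenever s shrinks by the factor b.

module Logarithm {c ℓ₁ ℓ₂} (F : OrderedField c ℓ₁ ℓ₂) (b : OrderedField.Carrier F)
                 (2≤b : OrderedFieldProperties.AtLeastTwo F b) where
  open OrderedField F hiding (zero)
  open OrderedFieldProperties F

  1<b : 1# < b
  1<b = begin-strict
    1#       ≈⟨ +-identityʳ 1# ⟨
    1# + 0#  <⟨ +-monoʳ-< 1# 0<1 ⟩
    1# + 1#  ≤⟨ 2≤b ⟩
    b        ∎

  1≤b : 1# ≤ b
  1≤b = <⇒≤ 1<b

  0<b : 0# < b
  0<b = <-trans 0<1 1<b

  -- Since b ≥ 2, the exponent `s` itself is large enough; this bounds the searches in `log-spec`
  -- and `ceilLog`.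
  fromℕ<b^ : ∀ s → fromℕ s < b ^ s
  fromℕ<b^ zero    = 0<1
  fromℕ<b^ (suc s) = begin-strict
    1# + fromℕ s             ≈⟨ +-comm 1# _ ⟩
    fromℕ s + 1#             <⟨ +-mono-<-≤ (fromℕ<b^ s) (1≤^ 1≤b s) ⟩
    b ^ s + b ^ s            ≈⟨ +-cong (*-identityˡ _) (*-identityˡ _) ⟨
    1# * b ^ s + 1# * b ^ s  ≈⟨ distribʳ (b ^ s) 1# 1# ⟨
    (1# + 1#) * b ^ s        ≤⟨ *-monoʳ-≤ (0≤^ (<⇒≤ 0<b) s) 2≤b ⟩
    b * b ^ s                ∎

  least : ∀ {p} {P : ℕ → Set p} → (∀ t → Dec (P t)) → ∀ t → P t →
          ∃[ t₀ ] (P t₀ × (∀ t′ → P t′ → t₀ ℕ.≤ t′))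
  least P? zero    Pt = zero , Pt , λ _ _ → z≤n
  least {P = P} P? (suc t) Pt with P? 0
  ... | yes P0 = zero , P0 , λ _ _ → z≤n
  ... | no ¬P0 with t₀ , Pt₀ , min ← least (λ t → P? (suc t)) t Pt =
    suc t₀ , Pt₀ , λ { zero P0 → contradiction P0 ¬P0 ; (suc t′) Pt′ → s≤s (min t′ Pt′) }

  -- The strict inequality gives a single point logarithm 1 and the empty piece 0, so that even the
  -- removal of a last point is visible in the charge.
  log-spec : ∀ s → ∃[ t ] (fromℕ s < b ^ t × (∀ t′ → fromℕ s < b ^ t′ → t ℕ.≤ t′))
  log-spec s = least (λ t → fromℕ s <? b ^ t) s (fromℕ<b^ s)
    where open StrictTotalOrder strictTotalOrder using (_<?_)

  log : ℕ → ℕ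
  log s = proj₁ (log-spec s)

  log-≤ : ∀ s t → fromℕ s < b ^ t → log s ℕ.≤ t
  log-≤ s = proj₂ (proj₂ (log-spec s))

  log-0 : log 0 ≡ 0
  log-0 = ℕₚ.n≤0⇒n≡0 (log-≤ 0 0 0<1)

  log-mono : ∀ {s s′} → s ℕ.≤ s′ → log s ℕ.≤ log s′
  log-mono {s} {s′} s≤s′ = log-≤ s (log s′) (begin-strict
    fromℕ s     ≤⟨ fromℕ-mono-≤ s≤s′ ⟩
    fromℕ s′    <⟨ proj₁ (proj₂ (log-spec s′)) ⟩
    b ^ log s′  ∎)

  -- Cancelling one factor b from b s′ ≤ s < b ^ (t + 1) leaves s′ < b ^ t. The value `log s` = 0
  -- would mean s < 1.
  log-shrink : ∀ {s s′} → 0 ℕ.< s → b * fromℕ s′ ≤ fromℕ s → log s′ ℕ.< log s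
  log-shrink {s} {s′} 0<s bs′≤s with log s | proj₁ (proj₂ (log-spec s))
  ... | zero  | s<1 = contradiction
    (begin 1#       ≈⟨ fromℕ-1 ⟨
           fromℕ 1  ≤⟨ fromℕ-mono-≤ 0<s ⟩
           fromℕ s  ∎)
    (<⇒≱ s<1)
  ... | suc t | s<b^t+1 = s≤s (log-≤ s′ t (*-cancelˡ-< (<⇒≤ 0<b) (begin-strict
    b * fromℕ s′  ≤⟨ bs′≤s ⟩
    fromℕ s       <⟨ s<b^t+1 ⟩
    b * b ^ t     ∎)))

  ceilLog : ∀ s → ∃[ t ] IsCeilLog b (fromℕ s) t
  ceilLog s = least (λ t → fromℕ s ≤? b ^ t) s (<⇒≤ (fromℕ<b^ s))

  1<fromℕ : ∀ {s} → 2 ℕ.≤ s → 1# < fromℕ s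
  1<fromℕ {s} 2≤s = begin-strict
    1#        ≈⟨ +-identityʳ 1# ⟨
    1# + 0#   <⟨ +-monoʳ-< 1# (0<fromℕ {1} (s≤s z≤n)) ⟩
    fromℕ 2   ≤⟨ fromℕ-mono-≤ 2≤s ⟩
    fromℕ s   ∎

  -- From s ≤ b ^ t < b ^ (t + 1) the logarithm is at most t + 1, and t ≥ 1 because s > 1; so t + 1
  -- ≤ 2t.
  log≤2*ceilLog : ∀ {s t} → 2 ℕ.≤ s → IsCeilLog b (fromℕ s) t → log s ℕ.≤ 2 ℕ.* t
  log≤2*ceilLog {s} {zero}  2≤s (s≤1 , _) = contradiction s≤1 (<⇒≱ (1<fromℕ 2≤s))
  log≤2*ceilLog {s} {suc t} 2≤s (s≤b^ , _) =
    ℕₚ.≤-trans (log-≤ s (suc (suc t)) (begin-strict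
      fromℕ s           ≤⟨ s≤b^ ⟩
      b ^ suc t         ≈⟨ *-identityˡ _ ⟨
      1# * b ^ suc t    <⟨ *-monoʳ-< (≤-<-trans′ (1≤^ 1≤b (suc t))) 1<b ⟩
      b * b ^ suc t     ∎))
    (s≤s (ℕₚ.≤-trans (ℕₚ.m≤n+m (suc t) t)
      (ℕₚ.+-monoʳ-≤ t (ℕₚ.≤-reflexive (≡.sym (ℕₚ.+-identityʳ (suc t)))))))
    where
    ≤-<-trans′ : ∀ {x} → 1# ≤ x → 0# < x
    ≤-<-trans′ {x} 1≤x = begin-strict 0# <⟨ 0<1 ⟩ 1# ≤⟨ 1≤x ⟩ x ∎

  -- If `log s` is t + 2, minimality gives b ^ (t + 1) ≤ s, and t + 2 ≤ 2(t + 1). If it is 1, the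
  -- claim is exactly b ≤ s²: this is where the condition on b comes from.
  b^log≤square : ∀ {s} → 1 ℕ.≤ s → b ≤ fromℕ s * fromℕ s → b ^ log s ≤ fromℕ s * fromℕ s
  b^log≤square {s} 1≤s b≤s² with log s | log-≤ s
  ... | zero  | _ = ≤-trans 1≤b b≤s²
  ... | suc zero | _ = begin
    b * 1#  ≈⟨ *-identityʳ b ⟩
    b       ≤⟨ b≤s² ⟩
    _       ∎
  ... | suc (suc t) | min = begin
    b ^ suc (suc t)              ≤⟨ ^-monoʳ-≤ 1≤b (s≤s (ℕₚ.m≤n+m (suc t) t)) ⟩
    b ^ (suc t ℕ.+ suc t)        ≈⟨ ^-homo-* b (suc t) (suc t) ⟩
    b ^ suc t * b ^ suc t        ≤⟨ *-mono-≤ 0≤b^ 0≤b^ b^t≤s b^t≤s ⟩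
    fromℕ s * fromℕ s            ∎
    where
    0≤b^ : 0# ≤ b ^ suc t
    0≤b^ = 0≤^ (<⇒≤ 0<b) (suc t)
    b^t≤s : b ^ suc t ≤ fromℕ s
    b^t≤s with b ^ suc t ≤? fromℕ s
    ... | yes b^t≤s = b^t≤s
    ... | no  b^t≰s = contradiction (min (suc t) (≰⇒> b^t≰s)) (ℕₚ.<⇒≱ ℕₚ.≤-refl)

  -- The square in `b^log≤square`, raised to the power `P`, is the factor 2 of the final bound.
  logBound : ∀ {s m P} → 1 ℕ.≤ s → m ℕ.≤ P ℕ.* log s → b ≤ fromℕ s * fromℕ s →
             LogBound m (2 ℕ.* P) b (fromℕ s)
  logBound {s} {m} {P} 1≤s m≤ b≤s² = begin
    b ^ m                     ≤⟨ ^-monoʳ-≤ 1≤b m≤ ⟩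
    b ^ (P ℕ.* log s)         ≡⟨ ≡.cong (b ^_) (ℕₚ.*-comm P (log s)) ⟩
    b ^ (log s ℕ.* P)         ≈⟨ ^-assocʳ b (log s) P ⟨
    (b ^ log s) ^ P           ≤⟨ ^-monoˡ-≤ (0≤^ (<⇒≤ 0<b) (log s)) (b^log≤square 1≤s b≤s²) P ⟩
    (fromℕ s * fromℕ s) ^ P   ≈⟨ ^-congˡ P (*-congˡ (*-identityʳ (fromℕ s))) ⟨
    (fromℕ s ^ 2) ^ P         ≈⟨ ^-assocʳ (fromℕ s) 2 P ⟩
    fromℕ s ^ (2 ℕ.* P)       ∎

-- The threshold η and the base b = 1/(1 - η)

module MergeThreshold {c ℓ₁ ℓ₂} (F : OrderedField c ℓ₁ ℓ₂) (η : OrderedField.Carrier F)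
                      (½<η : OrderedFieldProperties.MoreThanHalf F η)
                      (η<1 : OrderedField._<_ F η (OrderedField.1# F)) where
  open OrderedField F hiding (zero)
  open OrderedFieldProperties F
  open import Algebra.Properties.Group +-group using (//-rightDividesˡ)

  0<2 : 0# < 1# + 1#
  0<2 = begin-strict
    0#       ≈⟨ +-identityˡ 0# ⟨
    0# + 0#  <⟨ +-mono-<-≤ 0<1 0≤1 ⟩
    1# + 1#  ∎

  1<2η : 1# < (1# + 1#) * η
  1<2η = begin-strict
    1#                       ≈⟨ *-inverseʳ (λ 2≈0 → <-irrefl (sym 2≈0) 0<2) ⟨
    (1# + 1#) * (1# + 1#) ⁻¹ <⟨ *-monoˡ-< 0<2 ½<η ⟩
    (1# + 1#) * η            ∎

  -- The form in which η > 1/2 is applied: two η-fractions of one cluster overlap, and 1 - η is at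
  -- most one half.
  1<η+η : 1# < η + η
  1<η+η = begin-strict
    1#                 <⟨ 1<2η ⟩
    (1# + 1#) * η      ≈⟨ distribʳ η 1# 1# ⟩
    1# * η + 1# * η    ≈⟨ +-cong (*-identityˡ η) (*-identityˡ η) ⟩
    η + η              ∎

  0<η : 0# < η
  0<η = *-cancelˡ-< (<⇒≤ 0<2) (begin-strict
    (1# + 1#) * 0#   ≈⟨ zeroʳ _ ⟩
    0#               <⟨ 0<1 ⟩
    1#               <⟨ 1<2η ⟩
    (1# + 1#) * η    ∎)

  η≤1 : η ≤ 1#
  η≤1 = <⇒≤ η<1

  b : Carrier
  b = (1# - η) ⁻¹

  0<1-η : 0# < 1# - η
  0<1-η = x<y⇒0<y-x η<1

  [1-η]b≈1 : (1# - η) * b ≈ 1#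
  [1-η]b≈1 = *-inverseʳ (λ 1-η≈0 → <-irrefl (sym 1-η≈0) 0<1-η)

  0<b : 0# < b
  0<b = *-cancelˡ-< (<⇒≤ 0<1-η) (begin-strict
    (1# - η) * 0#   ≈⟨ zeroʳ _ ⟩
    0#              <⟨ 0<1 ⟩
    1#              ≈⟨ [1-η]b≈1 ⟨
    (1# - η) * b    ∎)

  1-η+1-η≤1 : (1# - η) + (1# - η) ≤ 1#
  1-η+1-η≤1 = +-cancelˡ-≤ (η + η) (begin
    (η + η) + ((1# - η) + (1# - η))   ≈⟨ +-interchange η η (1# - η) (1# - η) ⟩
    (η + (1# - η)) + (η + (1# - η))   ≈⟨ +-cong η+[1-η]≈1 η+[1-η]≈1 ⟩
    1# + 1#                           ≤⟨ +-monoˡ-≤ 1# (<⇒≤ 1<η+η) ⟩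
    (η + η) + 1#                      ∎)
    where
    open import Algebra.Properties.CommutativeSemigroup
      +-commutativeSemigroup
      renaming (interchange to +-interchange)
    η+[1-η]≈1 : η + (1# - η) ≈ 1#
    η+[1-η]≈1 = trans (+-comm η (1# - η)) (//-rightDividesˡ η 1#)

  2≤b : 1# + 1# ≤ b
  2≤b = begin
    1# + 1#                          ≈⟨ +-cong [1-η]b≈1 [1-η]b≈1 ⟨
    (1# - η) * b + (1# - η) * b      ≈⟨ distribʳ b (1# - η) (1# - η) ⟨
    ((1# - η) + (1# - η)) * b        ≤⟨ *-monoʳ-≤ (<⇒≤ 0<b) 1-η+1-η≤1 ⟩
    1# * b                           ≈⟨ *-identityˡ b ⟩
    b                                ∎

  -- Taking `r` ≥ ηs points out of s leaves at most (1 - η)s, and b is the inverse of 1 - η. This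
  -- loss factor is why the logarithm has base b.
  remainder : ∀ r s′ → η * fromℕ (r ℕ.+ s′) ≤ fromℕ r → b * fromℕ s′ ≤ fromℕ (r ℕ.+ s′)
  remainder r s′ ηs≤r = begin
    b * fromℕ s′                   ≤⟨ *-monoˡ-≤ (<⇒≤ 0<b) s′≤[1-η]s ⟩
    b * ((1# - η) * fromℕ s)       ≈⟨ *-assoc b (1# - η) (fromℕ s) ⟨
    (b * (1# - η)) * fromℕ s       ≈⟨ *-congʳ (trans (*-comm b (1# - η)) [1-η]b≈1) ⟩
    1# * fromℕ s                   ≈⟨ *-identityˡ _ ⟩
    fromℕ s                        ∎
    where
    s = r ℕ.+ s′
    s′≤[1-η]s : fromℕ s′ ≤ (1# - η) * fromℕ s
    s′≤[1-η]s = +-cancelˡ-≤ (η * fromℕ s) (begin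
      η * fromℕ s + fromℕ s′                 ≤⟨ +-monoˡ-≤ (fromℕ s′) ηs≤r ⟩
      fromℕ r + fromℕ s′                     ≈⟨ fromℕ-+ r s′ ⟨
      fromℕ s                                ≈⟨ *-identityˡ _ ⟨
      1# * fromℕ s                           ≈⟨ *-congʳ (//-rightDividesˡ η 1#) ⟨
      ((1# - η) + η) * fromℕ s               ≈⟨ *-congʳ (+-comm (1# - η) η) ⟩
      (η + (1# - η)) * fromℕ s               ≈⟨ distribʳ (fromℕ s) η (1# - η) ⟩
      η * fromℕ s + (1# - η) * fromℕ s       ∎)

-- Trees

tree-nonempty : ∀ {n} (t : Tree n) → Nonempty (points t)
tree-nonempty (leaf x)     = x , x∈⁅x⁆ x
tree-nonempty (node t₁ t₂) =
  let x , x∈t₁ = tree-nonempty t₁ in x , p⊆p∪q (points t₂) x∈t₁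

-- A `Tree` may repeat points, and then its nodes need not form a laminar family.
DisjointTree : ∀ {n} → Tree n → Set
DisjointTree (leaf x)     = ⊤
DisjointTree (node t₁ t₂) = Disjoint (points t₁) (points t₂) × DisjointTree t₁ × DisjointTree t₂

node-⊆ : ∀ {n} {T : Tree n} {d N} → NodeAt T d N → N ⊆ points T
node-⊆ here x∈N = x∈N
node-⊆ {T = node t₁ t₂} (left  at) x∈N = p⊆p∪q (points t₂) (node-⊆ at x∈N)
node-⊆ {T = node t₁ t₂} (right at) x∈N = q⊆p∪q (points t₁) (points t₂) (node-⊆ at x∈N)

-- Follow both paths from the root: either they part into disjoint subtrees, which excludes a common
-- point, or the path to the shallower node `N′` ends first and `N` lies below it.
node-laminar : ∀ {n} {T : Tree n} {d d′ N N′} → DisjointTree T →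
               NodeAt T d N → NodeAt T d′ N′ → d′ ℕ.≤ d → Nonempty (N ∩ N′) → N ⊆ N′
node-laminar _ at here _ _ = node-⊆ at
node-laminar (_ , # , _) (left  at) (left  at′) (s≤s d′≤d) = node-laminar # at at′ d′≤d
node-laminar (_ , _ , #) (right at) (right at′) (s≤s d′≤d) = node-laminar # at at′ d′≤d
node-laminar (t₁∩t₂=∅ , _) (left  at) (right at′) _ N∩N′≠∅ =
  contradiction N∩N′≠∅ (disjoint-⊆ (node-⊆ at) (node-⊆ at′) t₁∩t₂=∅)
node-laminar (t₁∩t₂=∅ , _) (right at) (left  at′) _ N∩N′≠∅ =
  contradiction N∩N′≠∅ (disjoint-⊆ (node-⊆ at) (node-⊆ at′) (disjoint-sym t₁∩t₂=∅))

-- Depths are recorded so that a deepest capturing node can be found by finite search.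
nodes : ∀ {n} (T : Tree n) → List (ℕ × Subset n)
nodes (leaf x)     = (0 , ⁅ x ⁆) ∷ []
nodes (node t₁ t₂) = (0 , points t₁ ∪ points t₂) ∷
  map (λ (d , N) → suc d , N) (nodes t₁ ++ nodes t₂)

nodes-sound : ∀ {n} (T : Tree n) {d N} → (d , N) ∈ˡ nodes T → NodeAt T d N
nodes-sound (leaf x) (here ≡.refl) = here
nodes-sound (node t₁ t₂) (here ≡.refl) = here
nodes-sound (node t₁ t₂) (there at) with ∈-map⁻ _ at
... | _ , at′ , ≡.refl with ∈-++⁻ (nodes t₁) at′
...   | inj₁ at₁ = left (nodes-sound t₁ at₁)
...   | inj₂ at₂ = right (nodes-sound t₂ at₂)

nodes-complete : ∀ {n} {T : Tree n} {d N} → NodeAt T d N → (d , N) ∈ˡ nodes T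
nodes-complete {T = leaf x}     here = here ≡.refl
nodes-complete {T = node t₁ t₂} here = here ≡.refl
nodes-complete (left at) = there (∈-map⁺ _ (∈-++⁺ˡ (nodes-complete at)))
nodes-complete {T = node t₁ t₂} (right at) =
  there (∈-map⁺ _ (∈-++⁺ʳ (nodes t₁) (nodes-complete at)))

-- Finite search for maximal choices

module _ {a} {A : Set a} where

  -- Pairs of positions in both orders, matching the quantifier over `ts ↭ u₁ ∷ u₂ ∷ rest′` in a
  -- linkage step, where equal trees may occur twice.
  orderedPairs : List A → List (A × A)
  orderedPairs []       = []
  orderedPairs (x ∷ xs) = map (x ,_) xs ++ map (_, x) xs ++ orderedPairs xs

  orderedPairs-sound : ∀ xs {u v} → (u , v) ∈ˡ orderedPairs xs → ∃[ ys ] xs ↭ u ∷ v ∷ ys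
  orderedPairs-sound (x ∷ xs) uv∈ with ∈-++⁻ (map (x ,_) xs) uv∈
  ... | inj₁ uv∈₁ with v , v∈ , ≡.refl ← ∈-map⁻ (x ,_) uv∈₁ =
    let ys , xs↭ = ∈⇒↭∷ v∈ in ys , ↭-prep x xs↭
  ... | inj₂ uv∈₂ with ∈-++⁻ (map (_, x) xs) uv∈₂
  ...   | inj₁ uv∈₃ with u , u∈ , ≡.refl ← ∈-map⁻ (_, x) uv∈₃ =
    let ys , xs↭ = ∈⇒↭∷ u∈ in ys , ↭-trans (↭-prep x xs↭) (↭-swap x u ↭-refl)
  ...   | inj₂ uv∈₄ =
    let ys , xs↭ = orderedPairs-sound xs uv∈₄
    in x ∷ ys , ↭-trans (↭-prep x xs↭) (↭-sym (shift x (_ ∷ _ ∷ []) ys))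

  orderedPairs-complete : ∀ {xs u v ys} → xs ↭ u ∷ v ∷ ys → (u , v) ∈ˡ orderedPairs xs
  orderedPairs-complete {[]} xs↭ = contradiction (↭-sym xs↭) ¬x∷xs↭[]
  orderedPairs-complete {x ∷ xs} {u} {v} xs↭ with ∈-resp-↭ xs↭ (here ≡.refl)
  ... | here ≡.refl = ∈-++⁺ˡ (∈-map⁺ _ (∈-resp-↭ (↭-sym (drop-∷ xs↭)) (here ≡.refl)))
  ... | there (here ≡.refl) = ∈-++⁺ʳ (map (x ,_) xs) (∈-++⁺ˡ (∈-map⁺ _
          (∈-resp-↭ (↭-sym (drop-∷ (↭-trans xs↭ (↭-swap u x ↭-refl)))) (here ≡.refl))))
  ... | there (there x∈ys) = let ys′ , ys↭ = ∈⇒↭∷ x∈ys in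
          ∈-++⁺ʳ (map (x ,_) xs) (∈-++⁺ʳ (map (_, x) xs) (orderedPairs-complete
            (drop-∷ (↭-trans xs↭ (↭-trans (↭-prep u (↭-prep v ys↭)) (shift x (u ∷ v ∷ []) ys′))))))

maximum : ∀ {a b ℓ₁ ℓ₂} {A : Set a} (O : TotalOrder b ℓ₁ ℓ₂) (f : A → TotalOrder.Carrier O) →
          ∀ {xs x} → x ∈ˡ xs → ∃[ y ] (y ∈ˡ xs × (∀ {z} → z ∈ˡ xs → TotalOrder._≤_ O (f z) (f y)))
maximum {A = A} O f {xs} {x} x∈ =
  best , best∈ (argmax-sel f x xs) , All.lookup (f[xs]≤f[argmax] {f = f} x xs)
  where
  open import Data.List.Extrema O using (argmax; argmax-sel; f[xs]≤f[argmax])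
  best : A
  best = argmax f x xs
  best∈ : best ≡ x ⊎ best ∈ˡ xs → best ∈ˡ xs
  best∈ (inj₁ best≡x) = ≡.subst (_∈ˡ xs) (≡.sym best≡x) x∈
  best∈ (inj₂ best∈′) = best∈′

-- Finite sums in an ordered field

module FiniteSums {c ℓ₁ ℓ₂} (F : OrderedField c ℓ₁ ℓ₂) where
  open OrderedField F hiding (zero)
  open OrderedFieldProperties F
  open import Algebra.Properties.CommutativeSemigroup
    +-commutativeSemigroup
    using () renaming (interchange to +-interchange)

  module _ {a} {A : Set a} where

    Σˡ : List A → (A → Carrier) → Carrier
    Σˡ xs f = foldr (λ x s → f x + s) 0# xs

    Σ-cong : ∀ {f g} → (∀ x → f x ≈ g x) → ∀ xs → Σˡ xs f ≈ Σˡ xs g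
    Σ-cong f≈g []       = refl
    Σ-cong f≈g (x ∷ xs) = +-cong (f≈g x) (Σ-cong f≈g xs)

    Σ-+ : ∀ f g xs → Σˡ xs (λ x → f x + g x) ≈ Σˡ xs f + Σˡ xs g
    Σ-+ f g []       = sym (+-identityˡ 0#)
    Σ-+ f g (x ∷ xs) = trans (+-congˡ (Σ-+ f g xs)) (+-interchange (f x) (g x) _ _)

    Σ-* : ∀ a f xs → Σˡ xs (λ x → a * f x) ≈ a * Σˡ xs f
    Σ-* a f []       = sym (zeroʳ a)
    Σ-* a f (x ∷ xs) = trans (+-congˡ (Σ-* a f xs)) (sym (distribˡ a (f x) _))

    Σ-const : ∀ a xs → Σˡ xs (λ _ → a) ≈ fromℕ (length xs) * a
    Σ-const a []       = sym (zeroˡ a)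
    Σ-const a (x ∷ xs) =
      trans (+-cong (sym (*-identityˡ a)) (Σ-const a xs)) (sym (distribʳ a 1# _))

    Σ-mono-≤ : ∀ {f g} xs → (∀ {x} → x ∈ˡ xs → f x ≤ g x) → Σˡ xs f ≤ Σˡ xs g
    Σ-mono-≤ []       f≤g = ≤-refl
    Σ-mono-≤ (x ∷ xs) f≤g = +-mono-≤ (f≤g (here ≡.refl)) (Σ-mono-≤ xs (f≤g ∘ there))

    Σ-mono-< : ∀ {f g} xs → 0 ℕ.< length xs → (∀ {x} → x ∈ˡ xs → f x < g x) → Σˡ xs f < Σˡ xs g
    Σ-mono-< (x ∷ xs) _ f<g =
      +-mono-<-≤ (f<g (here ≡.refl)) (Σ-mono-≤ xs (λ x∈ → <⇒≤ (f<g (there x∈))))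

  Σ-swap : ∀ {a b} {A : Set a} {B : Set b} (f : A → B → Carrier) xs ys →
           Σˡ xs (λ x → Σˡ ys (f x)) ≈ Σˡ ys (λ y → Σˡ xs (λ x → f x y))
  Σ-swap f [] ys =
    trans (sym (zeroʳ _)) (sym (Σ-const 0# ys))
  Σ-swap f (x ∷ xs) ys = trans (+-congˡ (Σ-swap f xs ys)) (sym (Σ-+ (f x) _ ys))

  -- Both sides are sums over all pairs from `ys` and `zs`, compared term by term; cross-multiplied
  -- lengths compare two averages without division.
  Σ-cross-< : ∀ {a b} {A : Set a} {B : Set b} {f : A → Carrier} {g : B → Carrier} ys zs →
              0 ℕ.< length ys → 0 ℕ.< length zs →
              (∀ {y z} → y ∈ˡ ys → z ∈ˡ zs → g z < f y) →
              fromℕ (length ys) * Σˡ zs g < fromℕ (length zs) * Σˡ ys f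
  Σ-cross-< {f = f} {g} ys zs 0<ys 0<zs g<f = begin-strict
    fromℕ (length ys) * Σˡ zs g               ≈⟨ Σ-const (Σˡ zs g) ys ⟨
    Σˡ ys (λ _ → Σˡ zs g)                     <⟨ Σ-mono-< ys 0<ys (λ y∈ → Σ-mono-< zs 0<zs (g<f y∈)) ⟩
    Σˡ ys (λ y → Σˡ zs (λ _ → f y))           ≈⟨ Σ-cong (λ y → Σ-const (f y) zs) ys ⟩
    Σˡ ys (λ y → fromℕ (length zs) * f y)     ≈⟨ Σ-* (fromℕ (length zs)) f ys ⟩
    fromℕ (length zs) * Σˡ ys f               ∎

-- Average-linkage trees

module AverageLinkageTree {c ℓ₁ ℓ₂} (F : OrderedField c ℓ₁ ℓ₂) {n : ℕ}
                          (S : Fin n → Fin n → OrderedField.Carrier F) where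
  open OrderedField F hiding (zero)
  open OrderedFieldProperties F
  open FiniteSums F
  open Similarity F S

  0<length-elements : ∀ {A : Subset n} → Nonempty A → 0 ℕ.< length (elements A)
  0<length-elements {A} A≠∅ = ≡.subst (0 ℕ.<_) (≡.sym (length-elements A)) (nonempty⇒0<∣∣ A≠∅)

  0<fromℕ∣∣ : ∀ {A : Subset n} → Nonempty A → 0# < fromℕ ∣ A ∣
  0<fromℕ∣∣ A≠∅ = 0<fromℕ (nonempty⇒0<∣∣ A≠∅)

  avg-spec : ∀ {A B} → Nonempty A → Nonempty B →
             avg A B * (fromℕ ∣ A ∣ * fromℕ ∣ B ∣) ≈ Σ∈ A (λ x → Σ∈ B (S x))
  avg-spec {A} {B} A≠∅ B≠∅ = begin-equality
    avg A B * (fromℕ ∣ A ∣ * fromℕ ∣ B ∣)   ≈⟨ *-congˡ (×1-homo-* ∣ A ∣ ∣ B ∣) ⟨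
    avg A B * fromℕ (∣ A ∣ ℕ.* ∣ B ∣)       ≈⟨ *-assoc _ _ _ ⟩
    Σ∈ A (λ x → Σ∈ B (S x)) * ((fromℕ (∣ A ∣ ℕ.* ∣ B ∣)) ⁻¹ * fromℕ (∣ A ∣ ℕ.* ∣ B ∣))
      ≈⟨ *-congˡ (trans (*-comm _ _) (*-inverseʳ (λ ≈0 → <-irrefl (sym ≈0) 0<AB))) ⟩
    Σ∈ A (λ x → Σ∈ B (S x)) * 1#            ≈⟨ *-identityʳ _ ⟩
    Σ∈ A (λ x → Σ∈ B (S x))                 ∎
    where
    0<AB : 0# < fromℕ (∣ A ∣ ℕ.* ∣ B ∣)
    0<AB = <-respʳ-≈ (sym (×1-homo-* ∣ A ∣ ∣ B ∣)) (*-pos (0<fromℕ∣∣ A≠∅) (0<fromℕ∣∣ B≠∅))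

  -- After multiplication by ∣A∣∣B∣∣C∣ the denominators cancel, and for each `x` in `A` the row sums
  -- over `C` and `B` are compared by `Σ-cross-<`.
  avg-< : ∀ {A B C} → Nonempty A → Nonempty B → Nonempty C →
          (∀ {x y z} → x ∈ A → y ∈ B → z ∈ C → S x z < S x y) → avg A C < avg A B
  avg-< {A} {B} {C} A≠∅ B≠∅ C≠∅ S< =
    *-cancelˡ-< (<⇒≤ (*-pos 0<p (*-pos 0<q 0<r))) (begin-strict
      (p * (q * r)) * avg A C              ≈⟨ *-congʳ (x∙yz≈y∙xz p q r) ⟩
      (q * (p * r)) * avg A C              ≈⟨ *-assoc q (p * r) _ ⟩
      q * ((p * r) * avg A C)              ≈⟨ *-congˡ (*-comm (p * r) _) ⟩
      q * (avg A C * (p * r))              ≈⟨ *-congˡ (avg-spec A≠∅ C≠∅) ⟩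
      q * Σ∈ A (λ x → Σ∈ C (S x))          ≈⟨ Σ-* q _ (elements A) ⟨
      Σ∈ A (λ x → q * Σ∈ C (S x))          <⟨ Σ-mono-< (elements A) (0<length-elements A≠∅) row ⟩
      Σ∈ A (λ x → r * Σ∈ B (S x))          ≈⟨ Σ-* r _ (elements A) ⟩
      r * Σ∈ A (λ x → Σ∈ B (S x))          ≈⟨ *-congˡ (avg-spec A≠∅ B≠∅) ⟨
      r * (avg A B * (p * q))              ≈⟨ *-congˡ (*-comm _ (p * q)) ⟩
      r * ((p * q) * avg A B)              ≈⟨ *-assoc r (p * q) _ ⟨
      (r * (p * q)) * avg A B              ≈⟨ *-congʳ (x∙yz≈z∙xy p q r) ⟨
      (p * (q * r)) * avg A B              ∎)
    where
    open import Algebra.Properties.CommutativeSemigroup *-commutativeSemigroup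
      using (x∙yz≈y∙xz; x∙yz≈z∙xy)
    p q r : Carrier
    p = fromℕ ∣ A ∣
    q = fromℕ ∣ B ∣
    r = fromℕ ∣ C ∣
    0<p : 0# < p
    0<p = 0<fromℕ∣∣ A≠∅
    0<q : 0# < q
    0<q = 0<fromℕ∣∣ B≠∅
    0<r : 0# < r
    0<r = 0<fromℕ∣∣ C≠∅
    row : ∀ {x} → x ∈ˡ elements A → q * Σ∈ C (S x) < r * Σ∈ B (S x)
    row {x} x∈ = ≡.subst₂ (λ i j → fromℕ i * Σ∈ C (S x) < fromℕ j * Σ∈ B (S x))
      (length-elements B) (length-elements C)
      (Σ-cross-< (elements B) (elements C) (0<length-elements B≠∅) (0<length-elements C≠∅)
        (λ y∈ z∈ → S< (∈-elements⁻ x∈) (∈-elements⁻ y∈) (∈-elements⁻ z∈)))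

  avg-comm : SymmetricSimilarity → ∀ A B → avg A B ≈ avg B A
  avg-comm S-sym A B = *-cong
    (trans (Σ-swap S (elements A) (elements B))
           (Σ-cong (λ y → Σ-cong (λ x → S-sym x y) (elements A)) (elements B)))
    (⁻¹-cong (reflexive (≡.cong fromℕ (ℕₚ.*-comm ∣ A ∣ ∣ B ∣))))

  linkage-∈⁻ : ∀ {ts T} → Linkage ts T → ∀ {x} → x ∈ points T → Any (λ t → x ∈ points t) ts
  linkage-∈⁻ done x∈T = here x∈T
  linkage-∈⁻ (join {t₁ = t₁} {t₂} ts↭ _ link) x∈T with linkage-∈⁻ link x∈T
  ... | there x∈rest = Any-resp-↭ (↭-sym ts↭) (there (there x∈rest))
  ... | here  x∈node = Any-resp-↭ (↭-sym ts↭)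
        ([ here , (λ x∈t₂ → there (here x∈t₂)) ]′ (x∈p∪q⁻ (points t₁) (points t₂) x∈node))

  linkage-∈⁺ : ∀ {ts T} → Linkage ts T → ∀ {x} → Any (λ t → x ∈ points t) ts → x ∈ points T
  linkage-∈⁺ done (here x∈T) = x∈T
  linkage-∈⁺ (join {t₁ = t₁} {t₂} ts↭ _ link) x∈ts with Any-resp-↭ ts↭ x∈ts
  ... | here x∈t₁             = linkage-∈⁺ link (here (p⊆p∪q (points t₂) x∈t₁))
  ... | there (here x∈t₂)     = linkage-∈⁺ link (here (q⊆p∪q (points t₁) (points t₂) x∈t₂))
  ... | there (there x∈rest)  = linkage-∈⁺ link (there x∈rest)

  linkage-disjoint : ∀ {ts T} → Linkage ts T → AllPairs (Disjoint on points) ts →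
                     All DisjointTree ts → DisjointTree T
  linkage-disjoint done _ (# ∷ []) = #
  linkage-disjoint (join ts↭ _ link) pairwise trees
    with (t₁#t₂ ∷ t₁#) ∷ t₂# ∷ rest# ← AllPairs-resp-↭ disjoint-sym ts↭ pairwise
       | #₁ ∷ #₂ ∷ #s ← All-resp-↭ ts↭ trees =
    linkage-disjoint link (All.zipWith (uncurry disjoint-∪) (t₁# , t₂#) ∷ rest#)
                          ((t₁#t₂ , #₁ , #₂) ∷ #s)

  linkage-node : ∀ {ts T} → Linkage ts T → ∀ {t d N} → t ∈ˡ ts → NodeAt t d N →
                 ∃[ d′ ] NodeAt T d′ N
  linkage-node done (here ≡.refl) at = _ , at
  linkage-node (join ts↭ _ link) t∈ts at with ∈-resp-↭ ts↭ t∈ts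
  ... | here ≡.refl         = linkage-node link (here ≡.refl) (left at)
  ... | there (here ≡.refl) = linkage-node link (here ≡.refl) (right at)
  ... | there (there t∈)    = linkage-node link (there t∈) at

  MaximalPair : List (Tree n) → Tree n × Tree n → Set _
  MaximalPair ts (t₁ , t₂) = ∀ {u₁ u₂ rest} → ts ↭ u₁ ∷ u₂ ∷ rest →
                             avg (points u₁) (points u₂) ≤ avg (points t₁) (points t₂)

  maximalPair : ∀ ts {p} → p ∈ˡ orderedPairs ts → ∃[ q ] (q ∈ˡ orderedPairs ts × MaximalPair ts q)
  maximalPair ts p∈ =
    let q , q∈ , max = maximum totalOrder (λ (t , u) → avg (points t) (points u)) p∈
    in q , q∈ , λ ts↭ → max (orderedPairs-complete ts↭)

  linkage-exists : ∀ k ts → length ts ≡ suc k → ∃[ T ] Linkage ts T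
  linkage-exists zero    (t ∷ [])     _ = t , done
  linkage-exists (suc k) ts@(_ ∷ _ ∷ _) eq = join-maximal (maximalPair ts (here ≡.refl))
    where
    join-maximal : ∃[ q ] (q ∈ˡ orderedPairs ts × MaximalPair ts q) → ∃[ T ] Linkage ts T
    join-maximal ((t₁ , t₂) , t₁t₂∈ , maximal) with orderedPairs-sound ts t₁t₂∈
    ... | rest , ts↭ with linkage-exists k (node t₁ t₂ ∷ rest)
                            (ℕₚ.suc-injective (≡.trans (≡.sym (↭-length ts↭)) eq))
    ...   | T , link = T , join ts↭ maximal link

  linkage-exists⁺ : ∀ ts → 0 ℕ.< length ts → ∃[ T ] Linkage ts T
  linkage-exists⁺ (t ∷ ts) _ = linkage-exists (length ts) (t ∷ ts) ≡.refl

  averageLinkage-exists : ∀ {Y} → Nonempty Y → ∃[ T ] AverageLinkage Y T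
  averageLinkage-exists {Y} Y≠∅ = linkage-exists⁺ (map leaf (elements Y))
    (≡.subst (0 ℕ.<_) (≡.sym (length-map leaf (elements Y))) (0<length-elements Y≠∅))

  averageLinkage-points : ∀ {Y T} → AverageLinkage Y T → points T ≡ Y
  averageLinkage-points {Y} {T} link = ⊆-antisym T⊆Y
    (λ {x} x∈Y → linkage-∈⁺ link (Anyₚ.map⁺ (Any.map (λ { ≡.refl → x∈⁅x⁆ x }) (∈-elements⁺ x∈Y))))
    where
    T⊆Y : points T ⊆ Y
    T⊆Y x∈T = let y , y∈ , x∈⁅y⁆ = find (Anyₚ.map⁻ (linkage-∈⁻ link x∈T))
              in ≡.subst (_∈ Y) (≡.sym (x∈⁅y⁆⇒x≡y y x∈⁅y⁆)) (∈-elements⁻ y∈)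

  averageLinkage-disjoint : ∀ {Y T} → AverageLinkage Y T → DisjointTree T
  averageLinkage-disjoint {Y} link = linkage-disjoint link
    (AllPairsₚ.map⁺ (AllPairs.map ⁅⁆-disjoint (Uniqueₚ.filter⁺ (_∈? Y) (Uniqueₚ.allFin⁺ n))))
    (Allₚ.map⁺ (All.tabulate (λ _ → tt)))
    where
    ⁅⁆-disjoint : ∀ {x y : Fin n} → x ≢ y → Disjoint ⁅ x ⁆ ⁅ y ⁆
    ⁅⁆-disjoint {x} {y} x≢y (z , z∈) =
      let z∈x , z∈y = x∈p∩q⁻ ⁅ x ⁆ ⁅ y ⁆ z∈
      in x≢y (≡.trans (≡.sym (x∈⁅y⁆⇒x≡y x z∈x)) (x∈⁅y⁆⇒x≡y y z∈y))

  -- Linkage and a separated set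

  module _ (S-sym : SymmetricSimilarity) {B : Subset n}
           (sep : ∀ {x y z} → x ∈ B → y ∈ B → z ∉ B → S x z < S x y) where

    Inside Outside : Tree n → Set
    Inside  t = points t ⊆ B
    Outside t = Disjoint (points t) B

    prefer-inside : ∀ {t u v} → Inside t → Inside u → Outside v →
                    avg (points t) (points v) < avg (points t) (points u)
    prefer-inside {t} {u} {v} t⊆B u⊆B v∩B=∅ =
      avg-< (tree-nonempty t) (tree-nonempty u) (tree-nonempty v)
        (λ x∈t y∈u z∈v → sep (t⊆B x∈t) (u⊆B y∈u) (disjoint-∉ v∩B=∅ z∈v))

    inside-or-outside : ∀ {ts} → All (λ t → Inside t ⊎ Outside t) ts → All Outside ts ⊎ Any Inside ts
    inside-or-outside [] = inj₁ []
    inside-or-outside (inj₁ t⊆B ∷ _) = inj₂ (here t⊆B)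
    inside-or-outside (inj₂ t∩B=∅ ∷ clean) with inside-or-outside clean
    ... | inj₁ outs = inj₁ (t∩B=∅ ∷ outs)
    ... | inj₂ ins  = inj₂ (there ins)

    -- Every point of `T` lies in one of the trees of `ts`, and all of them except `t` avoid `B`.
    -- This yields the desired node at the first merge across the boundary.
    unique-inside : ∀ {ts T t rest} → Linkage ts T → ts ↭ t ∷ rest → Inside t → All Outside rest →
                    points t ≡ B ∩ points T
    unique-inside {ts} {T} {t} link ts↭ t⊆B outs = ⊆-antisym
      (λ x∈t → x∈p∩q⁺ (t⊆B x∈t , linkage-∈⁺ link (Any-resp-↭ (↭-sym ts↭) (here x∈t))))
      back
      where
      back : B ∩ points T ⊆ points t
      back x∈ with x∈B , x∈T ← x∈p∩q⁻ B (points T) x∈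
        with Any-resp-↭ ts↭ (linkage-∈⁻ link x∈T)
      ... | here x∈t     = x∈t
      ... | there x∈rest with t′ , t′∈ , x∈t′ ← find x∈rest =
        contradiction x∈B (disjoint-∉ (All.lookup outs t′∈) x∈t′)

    -- While two trees lie inside B, a merge across the boundary of B is never of maximal
    -- average similarity; so when the first such merge happens, B is a single tree.
    clean-node : ∀ {ts T} → Linkage ts T → All (λ t → Inside t ⊎ Outside t) ts →
                 Nonempty (B ∩ points T) → ∃[ d ] NodeAt T d (B ∩ points T)
    clean-node {T = T} done (inj₁ T⊆B ∷ []) _ = 0 , ≡.subst (NodeAt T 0)
      (⊆-antisym (λ x∈T → x∈p∩q⁺ (T⊆B x∈T , x∈T)) (p∩q⊆q B (points T))) here
    clean-node done (inj₂ T∩B=∅ ∷ []) B∩T≠∅ = contradiction B∩T≠∅ (disjoint-sym T∩B=∅)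
    clean-node {T = T} link@(join {t₁ = t₁} {t₂} {rest} ts↭ max link′) clean B∩T≠∅
      with All-resp-↭ ts↭ clean
    ... | inj₁ t₁⊆B ∷ inj₁ t₂⊆B ∷ clean′ =
      clean-node link′ (inj₁ (∪-⊆ t₁⊆B t₂⊆B) ∷ clean′) B∩T≠∅
    ... | inj₂ t₁∩B=∅ ∷ inj₂ t₂∩B=∅ ∷ clean′ =
      clean-node link′ (inj₂ (disjoint-∪ t₁∩B=∅ t₂∩B=∅) ∷ clean′) B∩T≠∅
    ... | inj₁ t₁⊆B ∷ inj₂ t₂∩B=∅ ∷ clean′ with inside-or-outside clean′
    ...   | inj₁ outs = linkage-node link (∈-resp-↭ (↭-sym ts↭) (here ≡.refl))
              (≡.subst (NodeAt t₁ 0) (unique-inside link ts↭ t₁⊆B (t₂∩B=∅ ∷ outs)) here)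
    ...   | inj₂ ins with t₃ , t₃∈ , t₃⊆B ← find ins | rest′ , rest↭ ← ∈⇒↭∷ (proj₁ (proj₂ (find ins))) =
      contradiction (max (↭-trans ts↭ (↭-prep t₁ (↭-trans (↭-prep t₂ rest↭) (↭-swap t₂ t₃ ↭-refl)))))
        (<⇒≱ (prefer-inside {t₁} {t₃} {t₂} t₁⊆B t₃⊆B t₂∩B=∅))
    clean-node {T = T} link@(join {t₁ = t₁} {t₂} {rest} ts↭ max link′) clean B∩T≠∅
        | inj₂ t₁∩B=∅ ∷ inj₁ t₂⊆B ∷ clean′ with inside-or-outside clean′
    ...   | inj₁ outs = linkage-node link (∈-resp-↭ (↭-sym ts↭) (there (here ≡.refl)))
              (≡.subst (NodeAt t₂ 0)
                (unique-inside link (↭-trans ts↭ (↭-swap t₁ t₂ ↭-refl)) t₂⊆B (t₁∩B=∅ ∷ outs)) here)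
    ...   | inj₂ ins with t₃ , t₃∈ , t₃⊆B ← find ins | rest′ , rest↭ ← ∈⇒↭∷ (proj₁ (proj₂ (find ins))) =
      -- Maximality compares the pair (t₂, t₃) with (t₁, t₂); symmetry turns the latter so that both
      -- averages start from the inside tree t₂, as `prefer-inside` requires.
      contradiction
        (≤-trans (max (↭-trans ts↭ (↭-trans (↭-prep t₁ (↭-prep t₂ rest↭))
                                            (shift t₁ (t₂ ∷ t₃ ∷ []) rest′ ⁻))))
                 (≤-reflexive (avg-comm S-sym (points t₁) (points t₂))))
        (<⇒≱ (prefer-inside {t₂} {t₃} {t₁} t₂⊆B t₃⊆B t₁∩B=∅))
      where _⁻ = ↭-sym

    -- The leaves are singletons, hence each is inside or outside `B`, which is the starting
    -- condition of `clean-node`.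
    averageLinkage-node : ∀ {Y T} → AverageLinkage Y T → Nonempty (B ∩ Y) →
                          ∃[ d ] NodeAt T d (B ∩ Y)
    averageLinkage-node {Y} {T} link B∩Y≠∅ with ≡.refl ← averageLinkage-points link =
      clean-node link (Allₚ.map⁺ (All.tabulate (λ {x} _ → leaf-clean x))) B∩Y≠∅
      where
      leaf-clean : ∀ x → Inside (leaf x) ⊎ Outside (leaf x)
      leaf-clean x with x ∈? B
      ... | yes x∈B = inj₁ (λ y∈ → ≡.subst (_∈ B) (≡.sym (x∈⁅y⁆⇒x≡y x y∈)) x∈B)
      ... | no  x∉B = inj₂ (λ (y , y∈) → let y∈x , y∈B = x∈p∩q⁻ ⁅ x ⁆ B y∈
                                         in x∉B (≡.subst (_∈ B) (x∈⁅y⁆⇒x≡y x y∈x) y∈B))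

-- The interactive process

node-split : ∀ {n} {t₁ t₂ : Tree n} {d N} → NodeAt (node t₁ t₂) d N →
             N ≡ points t₁ ∪ points t₂ ⊎ (N ⊆ points t₁ ⊎ N ⊆ points t₂)
node-split here       = inj₁ ≡.refl
node-split (left  at) = inj₂ (inj₁ (node-⊆ at))
node-split (right at) = inj₂ (inj₂ (node-⊆ at))

-- Valid states and their preservation

module _ {n : ℕ} (𝒞* : Clustering n) where

  -- The meaning of the label `pure`; impure clusters satisfy it vacuously, so both children of a
  -- split do.
  Homogeneous : Subset n × Label → Set
  Homogeneous (C , l) = l ≡ pure → ∃[ B ] (B ∈ˡ clusters 𝒞* × C ⊆ B)

  record Valid (cs : State n) : Set where
    field
      nonempty    : All (λ c → Nonempty (proj₁ c)) cs
      disjoint    : AllPairs (Disjoint on proj₁) cs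
      covers      : ∀ x → Any (λ c → x ∈ proj₁ c) cs
      homogeneous : All Homogeneous cs

  open Valid public

  valid-↭ : ∀ {cs cs′} → cs ↭ cs′ → Valid cs → Valid cs′
  valid-↭ cs↭ v = record
    { nonempty    = All-resp-↭ cs↭ (nonempty v)
    ; disjoint    = AllPairs-resp-↭ disjoint-sym cs↭ (disjoint v)
    ; covers      = λ x → Any-resp-↭ cs↭ (covers v x)
    ; homogeneous = All-resp-↭ cs↭ (homogeneous v)
    }

  valid-keepNonempty : ∀ {cs} → AllPairs (Disjoint on proj₁) cs →
                       (∀ x → Any (λ c → x ∈ proj₁ c) cs) → All Homogeneous cs →
                       Valid (keepNonempty cs)
  valid-keepNonempty {cs} # covered hom = record
    { nonempty    = Allₚ.all-filter (λ c → nonempty? (proj₁ c)) cs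
    ; disjoint    = AllPairsₚ.filter⁺ (λ c → nonempty? (proj₁ c)) #
    ; covers      = λ x → let c , c∈ , x∈c = find (covered x) in
                          Any.map (λ { ≡.refl → x∈c })
                                  (∈-filter⁺ (λ c → nonempty? (proj₁ c)) c∈ (x , x∈c))
    ; homogeneous = Allₚ.filter⁺ (λ c → nonempty? (proj₁ c)) hom
    }

  valid-split : ∀ {C l rest t₁ t₂} → Valid ((C , l) ∷ rest) →
                C ≡ points t₁ ∪ points t₂ → Disjoint (points t₁) (points t₂) →
                Valid ((points t₁ , impure) ∷ (points t₂ , impure) ∷ rest)
  valid-split {C} {l} {rest} {t₁} {t₂} v ≡.refl t₁#t₂
    with C# ∷ rest# ← disjoint v | _ ∷ rest≠∅ ← nonempty v | _ ∷ hom ← homogeneous v = record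
    { nonempty    = tree-nonempty t₁ ∷ tree-nonempty t₂ ∷ rest≠∅
    ; disjoint    = (t₁#t₂ ∷ All.map (disjoint-⊆ (p⊆p∪q (points t₂)) id) C#) ∷
                    All.map (disjoint-⊆ (q⊆p∪q (points t₁) (points t₂)) id) C# ∷ rest#
    ; covers      = λ x → cover (covers v x)
    ; homogeneous = (λ ()) ∷ (λ ()) ∷ hom
    }
    where
    cover : ∀ {x} → Any (λ c → x ∈ proj₁ c) ((points t₁ ∪ points t₂ , l) ∷ rest) →
            Any (λ c → x ∈ proj₁ c) ((points t₁ , impure) ∷ (points t₂ , impure) ∷ rest)
    cover (there x∈) = there (there x∈)
    cover (here x∈) = [ here , (λ x∈t₂ → there (here x∈t₂)) ]′ (x∈p∪q⁻ (points t₁) (points t₂) x∈)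

  valid-merge : ∀ {C₁ l₁ C₂ l₂ rest N B} → Valid ((C₁ , l₁) ∷ (C₂ , l₂) ∷ rest) →
                B ∈ˡ clusters 𝒞* → N ⊆ B → Nonempty (N ∩ (C₁ ∪ C₂)) →
                Valid ((N ∩ (C₁ ∪ C₂) , pure) ∷
                       keepNonempty ((C₁ ─ N , l₁) ∷ (C₂ ─ N , l₂) ∷ []) ++ rest)
  valid-merge {C₁} {l₁} {C₂} {l₂} {rest} {N} {B} v B∈ N⊆B N∩Y≠∅
    with (C₁#C₂ ∷ C₁#) ∷ C₂# ∷ rest# ← disjoint v
       | _ ∷ _ ∷ rest≠∅ ← nonempty v
       | hom₁ ∷ hom₂ ∷ hom ← homogeneous v =
    ≡.subst Valid discard (valid-keepNonempty
      ((─-disjoint C₁ ∷ ─-disjoint C₂ ∷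
          All.zipWith (λ (#₁ , #₂) → disjoint-⊆ (p∩q⊆q N Y) id (disjoint-∪ #₁ #₂)) (C₁# , C₂#)) ∷
        (disjoint-⊆ (p─q⊆p C₁ N) (p─q⊆p C₂ N) C₁#C₂ ∷ All.map (disjoint-⊆ (p─q⊆p C₁ N) id) C₁#) ∷
        All.map (disjoint-⊆ (p─q⊆p C₂ N) id) C₂# ∷
        rest#)
      (λ x → cover (covers v x))
      ((λ _ → B , B∈ , N⊆B ∘ p∩q⊆p N Y) ∷ homogeneous-─ hom₁ ∷ homogeneous-─ hom₂ ∷ hom))
    where
    Y : Subset n
    Y = C₁ ∪ C₂
    ne? : Decidable {A = Subset n × Label} (λ c → Nonempty (proj₁ c))
    ne? c = nonempty? (proj₁ c)
    residues : State n
    residues = (C₁ ─ N , l₁) ∷ (C₂ ─ N , l₂) ∷ []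
    -- The clusters of `rest` are nonempty already, so filtering the whole new state agrees with
    -- filtering only the residues, as the merge procedure does.
    discard : keepNonempty ((N ∩ Y , pure) ∷ residues ++ rest) ≡
              (N ∩ Y , pure) ∷ keepNonempty residues ++ rest
    discard = ≡.trans (filter-accept ne? N∩Y≠∅) (≡.cong ((N ∩ Y , pure) ∷_)
      (≡.trans (filter-++ ne? residues rest)
               (≡.cong (keepNonempty residues ++_) (filter-all ne? (All.tail (All.tail (nonempty v)))))))
    ─-disjoint : ∀ C → Disjoint (N ∩ Y) (C ─ N)
    ─-disjoint C (x , x∈) = let x∈N∩Y , x∈C─N = x∈p∩q⁻ (N ∩ Y) (C ─ N) x∈
                            in x∈p─q⇒x∉q C N x∈C─N (p∩q⊆p N Y x∈N∩Y)
    homogeneous-─ : ∀ {C l} → Homogeneous (C , l) → Homogeneous (C ─ N , l)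
    homogeneous-─ {C} h l≡ = let B , B∈ , C⊆B = h l≡ in B , B∈ , C⊆B ∘ p─q⊆p C N
    cover : ∀ {x} → Any (λ c → x ∈ proj₁ c) ((C₁ , l₁) ∷ (C₂ , l₂) ∷ rest) →
            Any (λ c → x ∈ proj₁ c) ((N ∩ Y , pure) ∷ residues ++ rest)
    cover {x} x∈ with x ∈? N
    cover (here x∈C₁)         | yes x∈N = here (x∈p∩q⁺ (x∈N , p⊆p∪q C₂ x∈C₁))
    cover (there (here x∈C₂)) | yes x∈N = here (x∈p∩q⁺ (x∈N , q⊆p∪q C₁ C₂ x∈C₂))
    cover (here x∈C₁)         | no  x∉N = there (here (x∈p∧x∉q⇒x∈p─q x∈C₁ x∉N))
    cover (there (here x∈C₂)) | no  x∉N = there (there (here (x∈p∧x∉q⇒x∈p─q x∈C₂ x∉N)))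
    cover (there (there x∈))  | _       = there (there (there x∈))

-- The process under strict separation

module Process {c ℓ₁ ℓ₂} (F : OrderedField c ℓ₁ ℓ₂) {n : ℕ}
               (S : Fin n → Fin n → OrderedField.Carrier F)
               (η : OrderedField.Carrier F) (𝒞* 𝒞₀ : Clustering n)
               (S-sym : Similarity.SymmetricSimilarity F S)
               (separation : Similarity.StrictSeparation F S 𝒞*)
               (½<η : OrderedFieldProperties.MoreThanHalf F η)
               (η<1 : OrderedField._<_ F η (OrderedField.1# F)) where
  open OrderedField F hiding (zero)
  open OrderedFieldProperties F
  open Similarity F S
  open AverageLinkageTree F S
  open MergeThreshold F η ½<η η<1 hiding (0<b)
  open Logarithm F b 2≤b
  open Interaction F S η 𝒞* 𝒞₀

  targets : List (Subset n)
  targets = clusters 𝒞*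

  -- A point outside `B` lies in another target, so separation of pairs of targets becomes a
  -- condition on `B` alone, as the linkage argument requires.
  separated : ∀ {B} → B ∈ˡ targets → ∀ {x y z} → x ∈ B → y ∈ B → z ∉ B → S x z < S x y
  separated B∈ {z = z} x∈B y∈B z∉B =
    let B′ , B′∈ , z∈B′ = cluster-of 𝒞* z
    in separation B∈ B′∈ (λ { ≡.refl → z∉B z∈B′ }) x∈B y∈B z∈B′

  target-node : ∀ {B Y T} → B ∈ˡ targets → AverageLinkage Y T → Nonempty (B ∩ Y) →
                ∃[ d ] NodeAt T d (B ∩ Y)
  target-node B∈ = averageLinkage-node S-sym (separated B∈)

  -- If it is nonempty, `B ∩ C` is a node of the tree. It is not the root, because `C` meets a
  -- second target; so it lies in one child and `B` misses the other.
  split-clean : ∀ {C t₁ t₂} → 2 ℕ.≤ hits 𝒞* C → AverageLinkage C (node t₁ t₂) →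
                ∀ {B} → B ∈ˡ targets → Disjoint B (points t₁) ⊎ Disjoint B (points t₂)
  split-clean {C} {t₁} {t₂} 2≤hits link {B} B∈ with ≡.refl ← averageLinkage-points link
    with nonempty? (B ∩ C) | averageLinkage-disjoint link
  ... | no  B∩C=∅ | _ = inj₁ (disjoint-⊆ id (p⊆p∪q (points t₂)) B∩C=∅)
  ... | yes B∩C≠∅ | t₁#t₂ , _ with node-split (proj₂ (target-node B∈ link B∩C≠∅))
  ...   | inj₁ B∩C≡C = contradiction
            (⊆⇒hits≤1 𝒞* B∈ (p∩q⊆p B C ∘ ⊆-reflexive (≡.sym B∩C≡C))) (ℕₚ.<⇒≱ 2≤hits)
  ...   | inj₂ (inj₁ B∩C⊆t₁) = inj₂ λ (x , x∈) →
            let x∈B , x∈t₂ = x∈p∩q⁻ B (points t₂) x∈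
            in disjoint-∉ t₁#t₂ (B∩C⊆t₁ (x∈p∩q⁺ (x∈B , q⊆p∪q (points t₁) (points t₂) x∈t₂))) x∈t₂
  ...   | inj₂ (inj₂ B∩C⊆t₂) = inj₁ λ (x , x∈) →
            let x∈B , x∈t₁ = x∈p∩q⁻ B (points t₁) x∈
            in disjoint-∉ t₁#t₂ x∈t₁ (B∩C⊆t₂ (x∈p∩q⁺ (x∈B , p⊆p∪q (points t₂) x∈t₁)))

  fraction-nonempty : ∀ {C N} → Nonempty C → η Fraction C In N → Nonempty (N ∩ C)
  fraction-nonempty {C} {N} C≠∅ ηC≤N with ∣ N ∩ C ∣ in eq
  ... | suc _ = 0<∣∣⇒nonempty (≡.subst (0 ℕ.<_) (≡.sym eq) (s≤s z≤n))
  ... | zero  = contradiction ηC≤N (<⇒≱ (*-pos 0<η (0<fromℕ∣∣ C≠∅)))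

  -- Pigeonhole: disjoint `M` and `N` would together take 2η∣C∣ > ∣C∣ points of `C`.
  fractions-intersect : ∀ {C M N} → Nonempty C → η Fraction C In M → η Fraction C In N →
                        Nonempty (M ∩ N)
  fractions-intersect {C} {M} {N} C≠∅ ηC≤M ηC≤N with nonempty? (M ∩ N)
  ... | yes M∩N≠∅ = M∩N≠∅
  ... | no  M∩N=∅ = contradiction overfull (<⇒≱ (*-monoʳ-< (0<fromℕ∣∣ C≠∅) 1<η+η))
    where
    overfull : (η + η) * fromℕ ∣ C ∣ ≤ 1# * fromℕ ∣ C ∣
    overfull = begin
      (η + η) * fromℕ ∣ C ∣                   ≈⟨ distribʳ _ η η ⟩
      η * fromℕ ∣ C ∣ + η * fromℕ ∣ C ∣       ≤⟨ +-mono-≤ ηC≤M ηC≤N ⟩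
      fromℕ ∣ M ∩ C ∣ + fromℕ ∣ N ∩ C ∣       ≈⟨ fromℕ-+ ∣ M ∩ C ∣ ∣ N ∩ C ∣ ⟨
      fromℕ (∣ M ∩ C ∣ ℕ.+ ∣ N ∩ C ∣)
        ≤⟨ fromℕ-mono-≤ (disjoint-∣∣ (p∩q⊆q M C) (p∩q⊆q N C)
             (disjoint-⊆ (p∩q⊆p M C) (p∩q⊆p N C) M∩N=∅)) ⟩
      fromℕ ∣ C ∣                             ≈⟨ *-identityˡ _ ⟨
      1# * fromℕ ∣ C ∣                        ∎

  threshold≤1 : ∀ l → threshold l ≤ 1#
  threshold≤1 pure   = ≤-refl
  threshold≤1 impure = η≤1

  η≤threshold : ∀ l → η ≤ threshold l
  η≤threshold pure   = η≤1
  η≤threshold impure = ≤-refl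

  fraction-η : ∀ l {C N} → threshold l Fraction C In N → η Fraction C In N
  fraction-η l {C} = ≤-trans (*-monoʳ-≤ (0≤fromℕ ∣ C ∣) (η≤threshold l))

  ⊆⇒fraction : ∀ {θ C N} → θ ≤ 1# → C ⊆ N → θ Fraction C In N
  ⊆⇒fraction {θ} {C} {N} θ≤1 C⊆N = begin
    θ * fromℕ ∣ C ∣     ≤⟨ *-monoʳ-≤ (0≤fromℕ ∣ C ∣) θ≤1 ⟩
    1# * fromℕ ∣ C ∣    ≈⟨ *-identityˡ _ ⟩
    fromℕ ∣ C ∣         ≤⟨ fromℕ-mono-≤ (p⊆q⇒∣p∣≤∣q∣ (λ x∈C → x∈p∩q⁺ (C⊆N x∈C , x∈C))) ⟩
    fromℕ ∣ N ∩ C ∣     ∎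

  fraction-∩ : ∀ {θ C N Y} → C ⊆ Y → θ Fraction C In N → θ Fraction C In (N ∩ Y)
  fraction-∩ {θ} {C} {N} {Y} C⊆Y θC≤N = ≤-trans θC≤N (fromℕ-mono-≤ (p⊆q⇒∣p∣≤∣q∣ λ x∈ →
    let x∈N , x∈C = x∈p∩q⁻ N C x∈ in x∈p∩q⁺ (x∈p∩q⁺ (x∈N , C⊆Y x∈C) , x∈C)))

  -- For a pure `C` the threshold is 1 instead of η. But `C` lies in a single target, and a positive
  -- share in `B` makes that target `B`, so all of `C` is captured.
  target-captures : ∀ {B C l} → B ∈ˡ targets → Nonempty C → Homogeneous 𝒞* (C , l) →
                    η Fraction C In B → threshold l Fraction C In B
  target-captures {l = impure} _ _ _ ηC≤B = ηC≤B
  target-captures {B} {C} {pure} B∈ C≠∅ hom ηC≤B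
    with B′ , B′∈ , C⊆B′ ← hom ≡.refl | x , x∈ ← fraction-nonempty {C} {B} C≠∅ ηC≤B
    with x∈B , x∈C ← x∈p∩q⁻ B C x∈
    with ≡.refl ← cluster-≡ 𝒞* B∈ B′∈ x∈B (C⊆B′ x∈C) = ⊆⇒fraction ≤-refl C⊆B′

  -- `B ∩ (C₁ ∪ C₂)` is itself a capturing node, so `N` is at least as deep. Both hold an η-fraction
  -- of `C₁` and therefore meet, and laminarity puts `N` inside.
  deepest-⊆ : ∀ {C₁ l₁ C₂ l₂ rest B T d N} → Valid 𝒞* ((C₁ , l₁) ∷ (C₂ , l₂) ∷ rest) →
              B ∈ˡ targets → η Fraction C₁ In B → η Fraction C₂ In B →
              AverageLinkage (C₁ ∪ C₂) T → NodeAt T d N → Captures N (C₁ , l₁) (C₂ , l₂) →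
              (∀ {d′ N′} → NodeAt T d′ N′ → Captures N′ (C₁ , l₁) (C₂ , l₂) → d′ ℕ.≤ d) →
              N ⊆ B
  deepest-⊆ {C₁} {l₁} {C₂} {l₂} {B = B} {N = N} v B∈ ηC₁≤B ηC₂≤B link at (N₁ , N₂) max
    with C₁≠∅ ∷ C₂≠∅ ∷ _ ← nonempty v | hom₁ ∷ hom₂ ∷ _ ← homogeneous v
    with x , x∈ ← fraction-nonempty {C₁} {B} C₁≠∅ ηC₁≤B =
    let Y = C₁ ∪ C₂
        B₁ = fraction-∩ {N = B} (p⊆p∪q C₂) (target-captures {l = l₁} B∈ C₁≠∅ hom₁ ηC₁≤B)
        B₂ = fraction-∩ {N = B} (q⊆p∪q C₁ C₂) (target-captures {l = l₂} B∈ C₂≠∅ hom₂ ηC₂≤B)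
        _ , at′ = target-node B∈ link (x , ∩-monoʳ {C = B} (p⊆p∪q C₂) x∈)
    in p∩q⊆p B Y ∘ node-laminar (averageLinkage-disjoint link) at at′ (max at′ (B₁ , B₂))
         (fractions-intersect {C₁} {N} {B ∩ Y} C₁≠∅ (fraction-η l₁ {C₁} {N} N₁)
                                                   (fraction-η l₁ {C₁} {B ∩ Y} B₁))

  -- `excess` is the summand of δₒ, so its total is the overclustering error of the current state.
  charge excess : Subset n × Label → ℕ
  charge (C , pure)   = 1
  charge (C , impure) = mass log targets C
  excess (C , _)      = hits 𝒞* C ∸ 1

  total : (Subset n × Label → ℕ) → State n → ℕ
  total f cs = sum (map f cs)

  total-↭ : ∀ f {cs cs′} → cs ↭ cs′ → total f cs ≡ total f cs′
  total-↭ f cs↭ = sum-↭ (map⁺ f cs↭)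

  total-++ : ∀ f cs cs′ → total f (cs ++ cs′) ≡ total f cs ℕ.+ total f cs′
  total-++ f cs cs′ = ≡.trans (≡.cong sum (map-++ f cs cs′)) (sum-++ (map f cs) (map f cs′))

  -- Kept as a filtered list because `charge` gives an empty pure cluster the value 1: its unit is
  -- lost only when the empty residue is discarded.
  residue : Subset n → Subset n × Label → State n
  residue N (C , l) = keepNonempty ((C ─ N , l) ∷ [])

  total-residues : ∀ f N c₁ c₂ rest →
    total f (keepNonempty ((proj₁ c₁ ─ N , proj₂ c₁) ∷ (proj₁ c₂ ─ N , proj₂ c₂) ∷ []) ++ rest) ≡
    total f (residue N c₁) ℕ.+ (total f (residue N c₂) ℕ.+ total f rest)
  total-residues f N c₁ c₂ rest =
    ≡.trans (≡.cong (λ cs → total f (cs ++ rest))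
              (filter-++ (λ c → nonempty? (proj₁ c)) ((proj₁ c₁ ─ N , proj₂ c₁) ∷ []) _))
    (≡.trans (total-++ f (residue N c₁ ++ residue N c₂) rest)
    (≡.trans (≡.cong (ℕ._+ total f rest) (total-++ f (residue N c₁) (residue N c₂)))
             (ℕₚ.+-assoc (total f (residue N c₁)) _ _)))

  residue-≤ : ∀ f {N C l} → total f (residue N (C , l)) ℕ.≤ f (C ─ N , l)
  residue-≤ f {N} {C} with nonempty? (C ─ N)
  ... | yes _ = ℕₚ.≤-reflexive (ℕₚ.+-identityʳ _)
  ... | no  _ = z≤n

  residue-excess : ∀ {N C l} → total excess (residue N (C , l)) ℕ.≤ excess (C , l)
  residue-excess {N} {C} {l} = ℕₚ.≤-trans (residue-≤ excess {N} {C} {l})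
    (ℕₚ.∸-monoˡ-≤ 1 (≡.subst₂ ℕ._≤_ (≡.sym (length-meeting targets (C ─ N)))
                                     (≡.sym (length-meeting targets C))
                                     (mass-mono sgn-mono targets (p─q⊆p C N))))

  -- For impure `C`, all points taken lie in the piece `B ∩ C` and number at least η∣C∣ ≥ η∣B ∩ C∣,
  -- so `log-shrink` applies to that piece. For pure `C`, threshold 1 leaves an empty residue.
  residue-charge : ∀ {N B C l} → B ∈ˡ targets → N ⊆ B → Nonempty C → threshold l Fraction C In N →
                   total charge (residue N (C , l)) ℕ.< charge (C , l)
  residue-charge {N} {B} {C} {impure} B∈ N⊆B C≠∅ ηC≤N =
    ℕₚ.≤-<-trans (residue-≤ charge {N} {C} {impure})
      (mass-shrink 𝒞* log B∈ N⊆B (log-shrink {∣ B ∩ C ∣} {∣ B ∩ (C ─ N) ∣} 0<∣B∩C∣ shrunk))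
    where
    N∩C⊆B∩C : N ∩ C ⊆ B ∩ C
    N∩C⊆B∩C x∈ = let x∈N , x∈C = x∈p∩q⁻ N C x∈ in x∈p∩q⁺ (N⊆B x∈N , x∈C)
    0<∣B∩C∣ : 0 ℕ.< ∣ B ∩ C ∣
    0<∣B∩C∣ = let x , x∈ = fraction-nonempty {C} {N} C≠∅ ηC≤N
              in nonempty⇒0<∣∣ (x , N∩C⊆B∩C x∈)
    N∩[B∩C]≡N∩C : N ∩ (B ∩ C) ≡ N ∩ C
    N∩[B∩C]≡N∩C = ⊆-antisym (∩-monoʳ {C = N} (p∩q⊆q B C))
      (λ x∈ → x∈p∩q⁺ (p∩q⊆p N C x∈ , N∩C⊆B∩C x∈))
    [B∩C]─N≡B∩[C─N] : (B ∩ C) ─ N ≡ B ∩ (C ─ N)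
    [B∩C]─N≡B∩[C─N] = ⊆-antisym
      (λ x∈ → let x∈B , x∈C = x∈p∩q⁻ B C (p─q⊆p (B ∩ C) N x∈)
              in x∈p∩q⁺ (x∈B , x∈p∧x∉q⇒x∈p─q x∈C (x∈p─q⇒x∉q (B ∩ C) N x∈)))
      (λ x∈ → let x∈B , x∈C─N = x∈p∩q⁻ B (C ─ N) x∈
              in x∈p∧x∉q⇒x∈p─q (x∈p∩q⁺ (x∈B , p─q⊆p C N x∈C─N)) (x∈p─q⇒x∉q C N x∈C─N))
    ∣B∩C∣≡ : ∣ B ∩ C ∣ ≡ ∣ N ∩ C ∣ ℕ.+ ∣ B ∩ (C ─ N) ∣
    ∣B∩C∣≡ = ≡.trans (∣p∣≡∣q∩p∣+∣p─q∣ (B ∩ C) N)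
      (≡.cong₂ (λ P Q → ∣ P ∣ ℕ.+ ∣ Q ∣) N∩[B∩C]≡N∩C [B∩C]─N≡B∩[C─N])
    shrunk : b * fromℕ ∣ B ∩ (C ─ N) ∣ ≤ fromℕ ∣ B ∩ C ∣
    shrunk = ≡.subst (λ s → b * fromℕ ∣ B ∩ (C ─ N) ∣ ≤ fromℕ s) (≡.sym ∣B∩C∣≡)
      (remainder ∣ N ∩ C ∣ ∣ B ∩ (C ─ N) ∣
        (≡.subst (λ s → η * fromℕ s ≤ fromℕ ∣ N ∩ C ∣) ∣B∩C∣≡
          (≤-trans (*-monoˡ-≤ (<⇒≤ 0<η) (fromℕ-mono-≤ (∣p∩q∣≤∣q∣ B C))) ηC≤N)))
  residue-charge {N} {B} {C} {pure} _ _ _ C≤N =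
    s≤s (ℕₚ.≤-reflexive (≡.cong (total charge) (filter-reject (λ c → nonempty? (proj₁ c)) C─N=∅)))
    where
    C─N=∅ : Empty (C ─ N)
    C─N=∅ C─N≠∅ = ℕₚ.<⇒≱ (nonempty⇒0<∣∣ C─N≠∅) (ℕₚ.+-cancelˡ-≤ ∣ N ∩ C ∣ _ _
      (ℕₚ.≤-trans (ℕₚ.≤-reflexive (≡.sym (∣p∣≡∣q∩p∣+∣p─q∣ C N)))
      (ℕₚ.≤-trans (fromℕ-cancel-≤ (≤-trans (≤-reflexive (sym (*-identityˡ _))) C≤N))
                  (ℕₚ.≤-reflexive (≡.sym (ℕₚ.+-identityʳ _))))))

  -- Invariants of a run

  pieces δₒ : ℕ
  pieces = dist 𝒞* 𝒞₀ ℕ.+ size 𝒞*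
  δₒ     = dist 𝒞₀ 𝒞*

  -- Requests already made plus remaining potential stay within the initial budget. The field
  -- `small` serves n = 1, where ⌈log_b n⌉ is 0 although `log n` is 1; a merge takes two disjoint
  -- nonempty clusters and so forces n ≥ 2.
  record Invariant (s m : ℕ) (cs : State n) : Set where
    field
      valid  : Valid 𝒞* cs
      splits : s ℕ.+ total excess cs ℕ.≤ δₒ
      merges : m ℕ.+ total charge cs ℕ.≤ pieces ℕ.* log n
      small  : m ≡ 0 ⊎ 2 ℕ.≤ n

  open Invariant public

  invariant-initial : Invariant 0 0 initial
  invariant-initial = record
    { valid  = record
      { nonempty    = Allₚ.map⁺ (Clustering.nonempty 𝒞₀)
      ; disjoint    = AllPairsₚ.map⁺ (Clustering.disjoint 𝒞₀)
      ; covers      = λ x → Anyₚ.map⁺ (Clustering.covers 𝒞₀ x)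
      ; homogeneous = Allₚ.map⁺ (All.tabulate (λ _ ()))
      }
    ; splits = ℕₚ.≤-reflexive (≡.cong sum (≡.sym (map-∘ (clusters 𝒞₀))))
    ; merges = ℕₚ.≤-trans (ℕₚ.≤-reflexive (≡.cong sum (≡.sym (map-∘ (clusters 𝒞₀)))))
                          (sum-mass 𝒞₀ 𝒞* log (log n) log-0 (λ A → log-mono (∣p∣≤n A)))
    ; small  = inj₁ ≡.refl
    }

  invariant-split : ∀ {s m cs C l rest t₁ t₂} → Invariant s m cs → cs ↭ (C , l) ∷ rest →
                    2 ℕ.≤ hits 𝒞* C → AverageLinkage C (node t₁ t₂) →
                    Invariant (suc s) m ((points t₁ , impure) ∷ (points t₂ , impure) ∷ rest)
  invariant-split {s} {m} {cs} {C} {l} {rest} {t₁} {t₂} inv cs↭ 2≤hits link = record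
    { valid  = valid-split 𝒞* {t₁ = t₁} {t₂} v (≡.sym t₁∪t₂≡C) (proj₁ (averageLinkage-disjoint link))
    ; splits = ℕₚ.≤-trans (ℕₚ.≤-reflexive (≡.sym (ℕₚ.+-suc s _)))
        (ℕₚ.≤-trans (ℕₚ.+-monoʳ-≤ s excess-drop) (splits inv))
    ; merges = ℕₚ.≤-trans (ℕₚ.+-monoʳ-≤ m charge-preserved) (merges inv)
    ; small  = small inv
    }
    where
    v : Valid 𝒞* ((C , l) ∷ rest)
    v = valid-↭ 𝒞* cs↭ (valid inv)
    t₁∪t₂≡C : points t₁ ∪ points t₂ ≡ C
    t₁∪t₂≡C = averageLinkage-points link
    mass-C : ∀ f → f 0 ≡ 0 →
             mass f targets (points t₁) ℕ.+ mass f targets (points t₂) ≡ mass f targets C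
    mass-C f f0≡0 = ≡.trans (mass-split f f0≡0 targets (split-clean {C} {t₁} {t₂} 2≤hits link))
                            (≡.cong (mass f targets) t₁∪t₂≡C)
    -- The cluster being split meets two targets, so it cannot be pure and its charge is the sum
    -- over its pieces.
    impure-C : ∀ l → Homogeneous 𝒞* (C , l) → charge (C , l) ≡ mass log targets C
    impure-C impure _ = ≡.refl
    impure-C pure hom = let B , B∈ , C⊆B = hom ≡.refl
                        in contradiction (⊆⇒hits≤1 𝒞* B∈ C⊆B) (ℕₚ.<⇒≱ 2≤hits)
    charge-preserved : total charge ((points t₁ , impure) ∷ (points t₂ , impure) ∷ rest) ℕ.≤
                       total charge cs
    charge-preserved = ℕₚ.≤-reflexive
      (≡.trans (≡.sym (ℕₚ.+-assoc (mass log targets (points t₁)) _ _))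
      (≡.trans (≡.cong (ℕ._+ total charge rest)
                 (≡.trans (mass-C log log-0) (≡.sym (impure-C l (All.head (homogeneous v))))))
               (≡.sym (total-↭ charge cs↭))))
    hits-C : hits 𝒞* (points t₁) ℕ.+ hits 𝒞* (points t₂) ≡ hits 𝒞* C
    hits-C = ≡.trans (≡.cong₂ ℕ._+_ (length-meeting targets (points t₁))
                                    (length-meeting targets (points t₂)))
             (≡.trans (mass-C sgn ≡.refl) (≡.sym (length-meeting targets C)))
    excess-drop : suc (total excess ((points t₁ , impure) ∷ (points t₂ , impure) ∷ rest)) ℕ.≤
                  total excess cs
    excess-drop = ℕₚ.≤-trans
      (ℕₚ.≤-reflexive (≡.cong suc (≡.sym (ℕₚ.+-assoc (hits 𝒞* (points t₁) ∸ 1) _ _))))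
      (ℕₚ.≤-trans (ℕₚ.+-monoˡ-≤ (total excess rest)
          (∸1+∸1 (hits≥1 𝒞* (tree-nonempty t₁)) (hits≥1 𝒞* (tree-nonempty t₂))
                 (ℕₚ.≤-reflexive hits-C)))
        (ℕₚ.≤-reflexive (≡.sym (total-↭ excess cs↭))))

  invariant-merge : ∀ {s m cs C₁ l₁ C₂ l₂ rest T d N} → Invariant s m cs →
    cs ↭ (C₁ , l₁) ∷ (C₂ , l₂) ∷ rest →
    Any (λ B → η Fraction C₁ In B × η Fraction C₂ In B) targets →
    AverageLinkage (C₁ ∪ C₂) T → NodeAt T d N → Captures N (C₁ , l₁) (C₂ , l₂) →
    (∀ {d′ N′} → NodeAt T d′ N′ → Captures N′ (C₁ , l₁) (C₂ , l₂) → d′ ℕ.≤ d) →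
    Invariant s (suc m) ((N ∩ (C₁ ∪ C₂) , pure) ∷
                         keepNonempty ((C₁ ─ N , l₁) ∷ (C₂ ─ N , l₂) ∷ []) ++ rest)
  invariant-merge {s} {m} {cs} {C₁} {l₁} {C₂} {l₂} {rest} {N = N} inv cs↭ ok link at (N₁ , N₂) max
    with B , B∈ , ηC₁≤B , ηC₂≤B ← find ok
    with v ← valid-↭ 𝒞* cs↭ (valid inv)
    with C₁≠∅ ∷ C₂≠∅ ∷ _ ← nonempty v | (C₁#C₂ ∷ _) ∷ _ ← disjoint v
    with N⊆B ← deepest-⊆ {C₁} {l₁} {C₂} {l₂} {N = N} v B∈ ηC₁≤B ηC₂≤B link at (N₁ , N₂) max = record
    { valid  = valid-merge 𝒞* v B∈ N⊆B N∩Y≠∅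
    ; splits = ℕₚ.≤-trans (ℕₚ.+-monoʳ-≤ s excess-≤) (splits inv)
    ; merges = ℕₚ.≤-trans (ℕₚ.≤-reflexive (≡.sym (ℕₚ.+-suc m _)))
        (ℕₚ.≤-trans (ℕₚ.+-monoʳ-≤ m charge-drop) (merges inv))
    ; small  = inj₂ (≡.subst (2 ℕ.≤_) (∣⊤∣≡n n)
        (ℕₚ.≤-trans (ℕₚ.+-mono-≤ (nonempty⇒0<∣∣ C₁≠∅) (nonempty⇒0<∣∣ C₂≠∅))
                    (disjoint-∣∣ ⊆⊤ ⊆⊤ C₁#C₂)))
    }
    where
    N∩Y≠∅ : Nonempty (N ∩ (C₁ ∪ C₂))
    N∩Y≠∅ = let x , x∈ = fraction-nonempty {C₁} {N} C₁≠∅ (fraction-η l₁ {C₁} {N} N₁)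
            in x , ∩-monoʳ {C = N} (p⊆p∪q C₂) x∈
    excess-≤ : total excess ((N ∩ (C₁ ∪ C₂) , pure) ∷
                             keepNonempty ((C₁ ─ N , l₁) ∷ (C₂ ─ N , l₂) ∷ []) ++ rest) ℕ.≤
               total excess cs
    excess-≤ = ℕₚ.≤-trans
      (ℕₚ.+-mono-≤ (ℕₚ.∸-monoˡ-≤ 1 (⊆⇒hits≤1 𝒞* B∈ (N⊆B ∘ p∩q⊆p N (C₁ ∪ C₂))))
        (ℕₚ.≤-trans (ℕₚ.≤-reflexive (total-residues excess N (C₁ , l₁) (C₂ , l₂) rest))
          (ℕₚ.+-mono-≤ (residue-excess {N} {C₁} {l₁})
            (ℕₚ.+-monoˡ-≤ (total excess rest) (residue-excess {N} {C₂} {l₂})))))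
      (ℕₚ.≤-reflexive (≡.sym (total-↭ excess cs↭)))
    charge-drop : suc (total charge ((N ∩ (C₁ ∪ C₂) , pure) ∷
                    keepNonempty ((C₁ ─ N , l₁) ∷ (C₂ ─ N , l₂) ∷ []) ++ rest)) ℕ.≤
                  total charge cs
    charge-drop = ℕₚ.≤-trans
      (ℕₚ.≤-reflexive (≡.trans
        -- One of these two units is the charge of the new pure cluster, the other the required
        -- drop; they are covered by the units that `C₁` and `C₂` each lose.
        (≡.cong (2 ℕ.+_) (total-residues charge N (C₁ , l₁) (C₂ , l₂) rest))
        (≡.sym (ℕₚ.+-suc (suc (total charge (residue N (C₁ , l₁)))) _))))
      (ℕₚ.≤-trans (ℕₚ.+-mono-≤ (residue-charge {N} {B} {C₁} {l₁} B∈ N⊆B C₁≠∅ N₁)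
          (ℕₚ.+-monoˡ-≤ (total charge rest) (residue-charge {N} {B} {C₂} {l₂} B∈ N⊆B C₂≠∅ N₂)))
        (ℕₚ.≤-reflexive (≡.sym (total-↭ charge cs↭))))

  invariant : ∀ {s m cs} → Run s m cs → Invariant s m cs
  invariant start = invariant-initial
  invariant (step run (split at ok) (split link)) = invariant-split (invariant run) at ok link
  invariant (step run (merge at ok) (merge link deep captures max)) =
    invariant-merge (invariant run) at ok link deep captures max

  -- Existence of outcomes and requests

  captures? : ∀ c₁ c₂ → Decidable (λ N → Captures N c₁ c₂)
  captures? _ _ N = (_ ≤? _) ×-dec (_ ≤? _)

  root-captures : ∀ {C₁ l₁ C₂ l₂ T} → AverageLinkage (C₁ ∪ C₂) T →
                  Captures (points T) (C₁ , l₁) (C₂ , l₂)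
  root-captures {C₁} {l₁} {C₂} {l₂} link =
    ⊆⇒fraction (threshold≤1 l₁) (Y⊆T ∘ p⊆p∪q C₂) ,
    ⊆⇒fraction (threshold≤1 l₂) (Y⊆T ∘ q⊆p∪q C₁ C₂)
    where
    Y⊆T = ⊆-reflexive (≡.sym (averageLinkage-points link))

  outcome : ∀ {cs} → Valid 𝒞* cs → (q : Request cs) → ∃[ cs′ ] Outcome q cs′
  outcome v (split {C} cs↭ 2≤hits) with averageLinkage-exists (All.head (nonempty (valid-↭ 𝒞* cs↭ v)))
  ... | node t₁ t₂ , link = _ , split link
  -- A tree with one leaf means that `C` is a single point, which meets only one target.
  ... | leaf x     , link = contradiction
          (⊆⇒hits≤1 𝒞* B∈ λ y∈C → ≡.subst (_∈ B)
            (≡.sym (x∈⁅y⁆⇒x≡y x (≡.subst (_ ∈_) (≡.sym (averageLinkage-points link)) y∈C))) x∈B)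
          (ℕₚ.<⇒≱ 2≤hits)
    where
    B = proj₁ (cluster-of 𝒞* x)
    B∈ = proj₁ (proj₂ (cluster-of 𝒞* x))
    x∈B = proj₂ (proj₂ (cluster-of 𝒞* x))
  outcome v (merge {C₁} {l₁} {C₂} {l₂} cs↭ ok)
    with x , x∈C₁ ← All.head (nonempty (valid-↭ 𝒞* cs↭ v))
    with T , link ← averageLinkage-exists (x , p⊆p∪q C₂ x∈C₁)
    -- The maximum exists because the root always captures both clusters.
    with (d , N) , dN∈ , deepest ← maximum ℕₚ.≤-totalOrder proj₁
           (∈-filter⁺ (captures? (C₁ , l₁) (C₂ , l₂) ∘ proj₂) (nodes-complete {T = T} here)
                      (root-captures {C₁} {l₁} {C₂} {l₂} link))
    with at , captures ← ∈-filter⁻ (captures? (C₁ , l₁) (C₂ , l₂) ∘ proj₂) {xs = nodes T} dN∈ =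
    _ , merge link (nodes-sound T at) captures
          (λ at′ captures′ → deepest
            (∈-filter⁺ (captures? (C₁ , l₁) (C₂ , l₂) ∘ proj₂) (nodes-complete at′) captures′))

  -- A cluster that cannot be split lies in one target `B`. If no other cluster meets `B`, it equals
  -- `B`; otherwise such a cluster can be split, or lies in `B` too and the two can be merged.
  request-or-target : ∀ {cs} → Valid 𝒞* cs → ∀ {c} → c ∈ˡ cs → proj₁ c ∈ˡ targets ⊎ Request cs
  request-or-target {cs} v {C , l} c∈ with 2 ℕₚ.≤? hits 𝒞* C | ∈⇒↭∷ c∈
  ... | yes 2≤hits | rest , cs↭ = inj₂ (split cs↭ 2≤hits)
  ... | no  2≰hits | rest , cs↭ with v′ ← valid-↭ 𝒞* cs↭ v
    with B , B∈ , C⊆B ← hits≤1⇒⊆ 𝒞* (All.head (nonempty v′)) (ℕₚ.≤-pred (ℕₚ.≰⇒> 2≰hits))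
    with any? (λ c′ → nonempty? (B ∩ proj₁ c′)) rest
  ...   | no alone = inj₁ (≡.subst (_∈ˡ targets) (⊆-antisym B⊆C C⊆B) B∈)
    where
    B⊆C : B ⊆ C
    B⊆C {x} x∈B with covers v′ x
    ... | here x∈C     = x∈C
    ... | there x∈rest = contradiction (Any.map (λ x∈C′ → x , x∈p∩q⁺ (x∈B , x∈C′)) x∈rest) alone
  ...   | yes shared with (C′ , l′) , c′∈ , (x , x∈) ← find shared
    with rest′ , rest↭ ← ∈⇒↭∷ c′∈ | x∈B , x∈C′ ← x∈p∩q⁻ B C′ x∈
    with 2 ℕₚ.≤? hits 𝒞* C′
  ...     | yes 2≤hits′ = inj₂ (split
              (↭-trans cs↭ (↭-trans (↭-prep _ rest↭) (↭-swap _ _ ↭-refl))) 2≤hits′)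
  ...     | no  2≰hits′
    with B′ , B′∈ , C′⊆B′ ← hits≤1⇒⊆ 𝒞* (x , x∈C′) (ℕₚ.≤-pred (ℕₚ.≰⇒> 2≰hits′))
    with ≡.refl ← cluster-≡ 𝒞* B∈ B′∈ x∈B (C′⊆B′ x∈C′) =
    inj₂ (merge (↭-trans cs↭ (↭-prep _ rest↭))
      (Any.map (λ { ≡.refl → ⊆⇒fraction η≤1 C⊆B , ⊆⇒fraction η≤1 C′⊆B′ }) B∈))

  progress : ∀ {cs} → Valid 𝒞* cs → Found cs ⊎ Request cs
  progress {cs} v with All-⊎ (All.tabulate (request-or-target v))
  ... | inj₂ request   = inj₂ request
  ... | inj₁ in-target = inj₁ (mk⇔ to from)
    where
    to : ∀ {C} → C ∈ˡ map proj₁ cs → C ∈ˡ targets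
    to = All.lookup (Allₚ.map⁺ in-target)
    from : ∀ {B} → B ∈ˡ targets → B ∈ˡ map proj₁ cs
    from B∈ =
      let x , x∈B = All.lookup (Clustering.nonempty 𝒞*) B∈
          C , C∈ , x∈C = find (Anyₚ.map⁺ {f = proj₁} (covers v x))
      in ≡.subst (_∈ˡ map proj₁ cs) (cluster-≡ 𝒞* (to C∈) B∈ x∈C x∈B) C∈

  -- Final merge bounds

  merges≤ : ∀ {s m cs} → Invariant s m cs → m ℕ.≤ pieces ℕ.* log n
  merges≤ inv = ℕₚ.m+n≤o⇒m≤o _ (merges inv)

  merges≤ceilLog : ∀ {s m cs} → Invariant s m cs →
                   ∃[ t ] (IsCeilLog b (fromℕ n) t × m ℕ.≤ 2 ℕ.* pieces ℕ.* t)
  merges≤ceilLog inv with t , ceil ← ceilLog n | small inv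
  ... | inj₁ ≡.refl = t , ceil , z≤n
  ... | inj₂ 2≤n    = t , ceil , ℕₚ.≤-trans (merges≤ inv)
    (ℕₚ.≤-trans (ℕₚ.*-monoʳ-≤ pieces (log≤2*ceilLog 2≤n ceil)) (ℕₚ.≤-reflexive
      (≡.trans (≡.sym (ℕₚ.*-assoc pieces 2 t)) (≡.cong (ℕ._* t) (ℕₚ.*-comm pieces 2)))))

  merges-logBound : ∀ {s m cs} → Invariant s m cs → b ≤ fromℕ n * fromℕ n →
                    LogBound m (2 ℕ.* pieces) b (fromℕ n)
  merges-logBound inv b≤n² with 1 ℕₚ.≤? n
  ... | yes 1≤n = logBound {P = pieces} 1≤n (merges≤ inv) b≤n²
  -- For n = 0 the hypothesis reads b ≤ 0.
  ... | no  1≰n with ≡.refl ← ℕₚ.n<1⇒n≡0 (ℕₚ.≰⇒> 1≰n) =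
    contradiction (≤-trans b≤n² (≤-reflexive (zeroˡ 0#))) (<⇒≱ 0<b)

theorem16 :
  ∀ {c ℓ₁ ℓ₂} (F : OrderedField c ℓ₁ ℓ₂) →
  let open OrderedField F in
  ∀ (n : ℕ) (S : Fin n → Fin n → Carrier) (η : Carrier) (𝒞* 𝒞₀ : Clustering n) →
  let open Similarity F S
      open Interaction F S η 𝒞* 𝒞₀
      δₒ = dist 𝒞₀ 𝒞*
      δᵤ = dist 𝒞* 𝒞₀
      k = size 𝒞*
      K = 2 ℕ.* (δᵤ ℕ.+ k)
      b = (1# - η) ⁻¹
      n# = fromℕ n
  in
  SymmetricSimilarity →
  StrictSeparation 𝒞* →
  (1# + 1#) ⁻¹ < η →
  η < 1# →
  ∀ {s m cs} → Run s m cs →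
    -- split requests
    (s ℕ.≤ δₒ) ×
    -- merge requests: m ≤ K ⌈log_b n⌉, and m ≤ K log_b n once b ≤ n²
    (∃[ t ] (IsCeilLog b n# t × m ℕ.≤ K ℕ.* t)) ×
    (b ≤ n# * n# → LogBound m K b n#) ×
    -- requests remain possible until the target is found, and every
    -- allowed request can be carried out
    (Found cs ⊎ Request cs) ×
    (∀ (q : Request cs) → ∃[ cs′ ] Outcome q cs′)
theorem16 F n S η 𝒞* 𝒞₀ S-sym separation ½<η η<1 run =
  let open Process F S η 𝒞* 𝒞₀ S-sym separation ½<η η<1
      inv = invariant run
  in ℕₚ.m+n≤o⇒m≤o _ (splits inv) ,
     merges≤ceilLog inv ,
     merges-logBound inv ,
     progress (valid inv) ,
     outcome (valid inv)
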